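{- For any $A$-labeled pair of twin binary search trees $(T_L, T_R)$ as input, the algorithm ExtractMin (resp. ExtractMax) computes the minimal (resp. maximal) word for the lexicographic order of the $\equiv_{\mathrm{B}}$-equivalence class encoded by $(T_L, T_R)$. Moreover, if $(T_L, T_R)$ is labeled by a permutation, the computed word is the minimal (resp. maximal) permutation for the permutohedron order of its $\equiv_{\mathrm{B}}$-equivalence class.
   Context: $A = \{a_1 < a_2 < \cdots\}$ is a totally ordered infinite alphabet and $A^*$ is the free monoid of words on $A$. The Baxter congruence $\equiv_{\mathrm{B}}$ is the smallest congruence (equivalence relation compatible with concatenation) on $A^*$ such that, for all words $u, v$ and letters $a,b,c,d$: $\; c\,u\,a d\,v\,b \equiv_{\mathrm{B}} c\,u\,d a\,v\,b$ whenever $a \leq b < c \leq d$, and $\; b\,u\,d a\,v\,c \equiv_{\mathrm{B}} b\,u\,a d\,v\,c$ whenever $a < b \leq c < d$. Permutations of size $n$ are words of length $n$ without repetition on the first $n$ letters of $A$ (identified with $1,\dots,n$). The permutohedron order on permutations of size $n$ is the partial order in which $\sigma$ is covered by $\nu$ iff $\sigma = u\,ab\,v$ and $\nu = u\,ba\,v$ for some words $u,v$ and letters $a<b$. A binary tree is either a leaf (empty tree) or a node with a left and a right binary subtree. The $i$-th node is the $i$-th node visited by the inorder traversal (left subtree, root, right subtree); the inorder reading of a labeled tree is the word of labels in this order. The canopy of a binary tree with $n$ nodes is the word of length $n-1$ obtained by reading its leaves from left to right except the first and the last, writing $0$ if the leaf is a right child and $1$ if it is a left child. Two binary trees $(T_L,T_R)$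 with $n$ nodes form a pair of twin binary trees if their canopies differ at every position $1\le i\le n-1$. A tree labeled by $A$ is a right (resp. left) binary search tree if for each node labeled $b$, all labels $a$ in its left subtree and $c$ in its right subtree satisfy $a \leq b < c$ (resp. $a < b \leq c$). A pair of twin binary search trees is an $A$-labeled pair of twin binary trees $(T_L,T_R)$ with $T_L$ a left binary search tree, $T_R$ a right binary search tree, and both having the same inorder reading. It is labeled by a permutation if the labels of each tree with $n$ nodes are $1,\dots,n$, each used once. Leaf insertion of a letter $a$ into a right (resp. left) binary search tree: in the empty tree, create a node labeled $a$; otherwise, with $b$ the root label, insert recursively into the left subtree if $a \leq b$ (resp. $a<b$), and into the right subtree otherwise. For $u \in A^*$, $\mathsf{P}(u) = (T_L,T_R)$ where $T_L$ (resp. $T_R$) is the left (resp. right) binary search tree obtained by leaf inserting the letters of $u$ from left to right (resp. right to left). The class encoded by $(T_L,T_R)$ is the $\equiv_{\mathrm{B}}$-equivalence class of the words $u$ with $\mathsf{P}(u) = (T_L,T_R)$. Algorithm ExtractMin, on input $(T_L,T_R)$ (throughout the execution, nodes are designated by their inorder indices in the input trees): (1) let $u$ be the empty word. (2) Let $F := T_L$, seen as a rooted forest. (3) While $F$ and $T_R$ are not empty: (a) let $i$ be the smallest index such that the $i$-th node is a root of $F$ and the $i$-th node of $T_R$ has no child; (b) let $a$ be the label of the $i$-th node of $T_L$; (c) set $u := u a$; (d) suppress the $i$-th node of $F$ (the subtrees below it become trees of the forest) and the $i$-th node of $T_R$. (4) Return $u$. Algorithm ExtractMax is the variant in which in step (a)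 the greatest such index is chosen instead of the smallest. -}

module Defs where

open import Data.Bool.Base using (Bool; true; false; if_then_else_; _∧_)
open import Data.List.Base as List
  using (List; []; _∷_; _++_; _∷ʳ_; length; take; drop; upTo; filter)
open import Data.List.Relation.Binary.Lex.Strict using (Lex-≤)
open import Data.List.Relation.Binary.Permutation.Propositional using (_↭_)
open import Data.List.Relation.Binary.Pointwise using (Pointwise)
import Data.List.Relation.Unary.All as ListAll
open import Data.List.Relation.Unary.Unique.Propositional using (Unique)
open import Data.Maybe.Base using (Maybe; just; nothing; _>>=_)
open import Data.Nat.Base using (ℕ; zero; suc; _+_; _∸_; _≤_; _<_)
open import Data.Nat.Properties using (_≟_; _≤?_; _<?_; ≤-totalOrder)
open import Data.List.Membership.DecPropositional _≟_ using (_∈?_)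
open import Data.List.Extrema ≤-totalOrder using (argmin; argmax)
open import Data.Product.Base using (_×_; _,_; ∃-syntax; proj₁; proj₂)
open import Data.Tree.Binary using (Tree; leaf; node; #nodes; module Infix; module Leaves)
open import Data.Tree.Binary.Relation.Unary.All as TreeAll using ()
open import Data.Unit.Base using (⊤; tt)
open import Function.Base using (flip)
open import Level using (0ℓ)
open import Relation.Binary.Core using (Rel)
open import Relation.Binary.Construct.Closure.ReflexiveTransitive using (Star)
open import Relation.Binary.PropositionalEquality using (_≡_; _≢_)
open import Relation.Nullary.Decidable using (does)
open import Relation.Unary using (Pred; U)

------------------------------------------------------------------------
-- Words

-- The k-th letter a_k of the alphabet is represented by the number k - 1,
-- so the first n letters are 0, …, n - 1.
Letter : Set
Letter = ℕ

Word : Set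
Word = List Letter

infix 4 _≡ᴮ_ _⋖_ _≤ᴾ_ _≤ˡᵉˣ_

data _≡ᴮ_ : Rel Word 0ℓ where
  refl    : ∀ {u} → u ≡ᴮ u
  sym     : ∀ {u v} → u ≡ᴮ v → v ≡ᴮ u
  trans   : ∀ {u v w} → u ≡ᴮ v → v ≡ᴮ w → u ≡ᴮ w
  ++-cong : ∀ {u u′ v v′} → u ≡ᴮ u′ → v ≡ᴮ v′ → u ++ v ≡ᴮ u′ ++ v′
  cuadvb  : ∀ u v {a b c d} → a ≤ b → b < c → c ≤ d →
            c ∷ u ++ a ∷ d ∷ v ++ b ∷ [] ≡ᴮ c ∷ u ++ d ∷ a ∷ v ++ b ∷ []
  budavc  : ∀ u v {a b c d} → a < b → b ≤ c → c < d →
            b ∷ u ++ d ∷ a ∷ v ++ c ∷ [] ≡ᴮ b ∷ u ++ a ∷ d ∷ v ++ c ∷ []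

_≤ˡᵉˣ_ : Rel Word 0ℓ
_≤ˡᵉˣ_ = Lex-≤ _≡_ _<_

record IsPermutation (n : ℕ) (w : Word) : Set where
  field
    length≡  : length w ≡ n
    unique   : Unique w
    letters< : ListAll.All (_< n) w

data _⋖_ : Rel Word 0ℓ where
  swap : ∀ u v {a b} → a < b → u ++ a ∷ b ∷ v ⋖ u ++ b ∷ a ∷ v

-- Exchanging two letters preserves being a permutation, so on permutations
-- this closure is the order generated by the covers between permutations.
_≤ᴾ_ : Rel Word 0ℓ
_≤ᴾ_ = Star _⋖_

IsLeast : Rel Word 0ℓ → Pred Word 0ℓ → Pred Word 0ℓ
IsLeast _≼_ C w = C w × (∀ v → C v → w ≼ v)

IsGreatest : Rel Word 0ℓ → Pred Word 0ℓ → Pred Word 0ℓ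
IsGreatest _≼_ = IsLeast (flip _≼_)

------------------------------------------------------------------------
-- Twin binary search trees

BTree : Set → Set
BTree N = Tree N ⊤

LTree : Set
LTree = BTree Letter

pattern ∙ = leaf tt

inorder : LTree → Word
inorder = Infix.toList

-- true (the bit 1) marks left children and false (the bit 0) right children;
-- the first argument is the mark for the root.
markLeaves : {N : Set} → Bool → BTree N → Tree N Bool
markLeaves s (leaf _)     = leaf s
markLeaves s (node l x r) = node (markLeaves true l) x (markLeaves false r)

-- A tree with n nodes has n + 1 leaves. The mark chosen for the root is
-- visible only in the empty tree, whose canopy is empty anyway.
canopy : {N : Set} → BTree N → List Bool
canopy t = take (#nodes t ∸ 1) (drop 1 (Leaves.toList (markLeaves true t)))

data LeftBST : Pred LTree 0ℓ where
  leaf : LeftBST ∙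
  node : ∀ {l b r} → TreeAll.All (_< b) U l → TreeAll.All (b ≤_) U r →
         LeftBST l → LeftBST r → LeftBST (node l b r)

data RightBST : Pred LTree 0ℓ where
  leaf : RightBST ∙
  node : ∀ {l b r} → TreeAll.All (_≤ b) U l → TreeAll.All (b <_) U r →
         RightBST l → RightBST r → RightBST (node l b r)

record IsTwinBST (TL TR : LTree) : Set where
  field
    #nodes≡  : #nodes TL ≡ #nodes TR
    twin     : Pointwise _≢_ (canopy TL) (canopy TR)
    leftBST  : LeftBST TL
    rightBST : RightBST TR
    inorder≡ : inorder TL ≡ inorder TR

LabeledByPermutation : LTree → LTree → Set
LabeledByPermutation TL TR =
  inorder TL ↭ upTo (#nodes TL) × inorder TR ↭ upTo (#nodes TR)

------------------------------------------------------------------------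
-- Insertion

insertᴸ : Letter → LTree → LTree
insertᴸ a (leaf _)     = node ∙ a ∙
insertᴸ a (node l b r) =
  if does (a <? b) then node (insertᴸ a l) b r else node l b (insertᴸ a r)

insertᴿ : Letter → LTree → LTree
insertᴿ a (leaf _)     = node ∙ a ∙
insertᴿ a (node l b r) =
  if does (a ≤? b) then node (insertᴿ a l) b r else node l b (insertᴿ a r)

P : Word → LTree × LTree
P u = List.foldl (flip insertᴸ) ∙ u , List.foldr insertᴿ ∙ u

EncodedBy : LTree → LTree → Pred Word 0ℓ
EncodedBy TL TR v = ∃[ u ] P u ≡ (TL , TR) × u ≡ᴮ v

------------------------------------------------------------------------
-- ExtractMin and ExtractMax

-- A node of a tree during the execution: its inorder index in the input tree
-- and its label.
Node : Set
Node = ℕ × Letter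

number : ℕ → LTree → BTree Node
number k (leaf _)     = ∙
number k (node l a r) =
  node (number k l) (k + #nodes l , a) (number (suc (k + #nodes l)) r)

-- The trees of a forest are nonempty.
record NonEmptyTree : Set where
  constructor tree
  field
    left  : BTree Node
    root  : Node
    right : BTree Node

Forest : Set
Forest = List NonEmptyTree

plant : BTree Node → Forest → Forest
plant (leaf _)     F = F
plant (node l x r) F = tree l x r ∷ F

roots : Forest → List Node
roots = List.map NonEmptyTree.root

suppressRoot : ℕ → Forest → Forest
suppressRoot i []                     = []
suppressRoot i (tree l (j , a) r ∷ F) =
  if does (i ≟ j) then plant l (plant r F) else tree l (j , a) r ∷ suppressRoot i F

isEmpty : BTree Node → Bool
isEmpty (leaf _)     = true
isEmpty (node _ _ _) = false

childless : BTree Node → List Node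
childless (leaf _)     = []
childless (node l x r) =
  if isEmpty l ∧ isEmpty r then x ∷ [] else childless l ++ childless r

-- Only used when the node of index i has no child.
suppressChildless : ℕ → BTree Node → BTree Node
suppressChildless i (leaf _)           = ∙
suppressChildless i (node l (j , a) r) =
  if does (i ≟ j) then ∙
  else node (suppressChildless i l) (j , a) (suppressChildless i r)

candidates : Forest → BTree Node → List Node
candidates F T = filter (λ x → proj₁ x ∈? List.map proj₁ (childless T)) (roots F)

Choice : Set
Choice = List Node → Maybe Node

smallest : Choice
smallest []       = nothing
smallest (x ∷ xs) = just (argmin proj₁ x xs)

greatest : Choice
greatest []       = nothing
greatest (x ∷ xs) = just (argmax proj₁ x xs)

-- The result nothing means that no index qualifies in some iteration, or that
-- the given number of iterations does not suffice.
loop : Choice → ℕ → Word → Forest → BTree Node → Maybe Word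
loop choose _       u []        _              = just u
loop choose _       u (_ ∷ _)   (leaf _)       = just u
loop choose zero    u (_ ∷ _)   (node _ _ _)   = nothing
loop choose (suc k) u F@(_ ∷ _) T@(node _ _ _) =
  choose (candidates F T) >>= λ (i , a) →
    loop choose k (u ∷ʳ a) (suppressRoot i F) (suppressChildless i T)

-- Each iteration suppresses a node of TR, so #nodes TR iterations suffice.
extract : Choice → LTree → LTree → Maybe Word
extract choose TL TR =
  loop choose (#nodes TR) [] (plant (number 1 TL) []) (number 1 TR)

extractMin extractMax : LTree → LTree → Maybe Word
extractMin = extract smallest
extractMax = extract greatest

{-# OPTIONS --safe #-}

-- The words encoded by (TL , TR) are the common linear extensions of two orders on the nodes,
-- "ancestors first" in TL and "descendants first" in TR; here equal letters of a word are
-- numbered from left to right, so that the nodes are recovered from the letters.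
--
-- If z is a descendant of y, then so is every node between y and z in inorder. Let i be the least
-- node that can come first and s any linear extension. If some k < i preceded i in s, the first
-- such k would have to be preceded by a j required to come before it; then k < i < j, and i would
-- be a descendant of j in TL or of k in TR, which is impossible. So i can be moved to the front of
-- s by exchanging it with greater nodes only. Hence the greedy extension lies below every other
-- one in the permutohedron order on words, which implies the lexicographic order. ExtractMax is
-- dual.
--
-- A removable node always exists: a root of the forest is blocked only by an inorder neighbour
-- in an adjacent tree of the forest, and each of the gaps between the trees blocks at most one
-- root. Here twinness is used in the form that no two inorder neighbours are ordered in the same
-- way in both trees; this is inherited because deleting a root of the forest separates its
-- two neighbours.

module Submission where

open import Defs
open import Data.Bool.Base using (Bool; true; false; if_then_else_)
open import Data.Empty using (⊥; ⊥-elim)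
open import Data.List.Base
  using (List; []; _∷_; _++_; _∷ʳ_; map; length; foldl; foldr; filter; reverse; take; drop; upTo)
open import Data.List.Membership.Propositional using (_∈_)
open import Data.List.Membership.Propositional.Properties
  using (∈-++⁺ˡ; ∈-++⁺ʳ; ∈-++⁻; ∈-map⁺; ∈-map⁻; ∈-filter⁺; ∈-filter⁻)
open import Data.List.Properties
  using (++-assoc; ++-identityʳ; foldl-++; foldr-++; foldl-cong; filter-++; filter-all; filter-none;
         reverse-foldl; reverse-map; unfold-reverse; reverse-involutive; length-++;
         length-map; length-upTo)
open import Data.List.Relation.Binary.Lex.Core using (this; next)
import Data.List.Relation.Binary.Lex.Strict as Lex
open import Data.List.Relation.Binary.Permutation.Propositional
  using (_↭_; prep; ↭-refl; ↭-reflexive; ↭-sym; ↭-trans; ↭-swap; ↭⇒↭ₛ)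
open import Data.List.Relation.Binary.Permutation.Propositional.Properties
  using (∈-resp-↭; All-resp-↭; drop-∷; drop-mid; ↭-empty-inv; shift; filter-↭; map⁺; ++⁺ˡ; ++⁺ʳ;
         ↭-length; ↭-reverse)
open import Data.List.Relation.Binary.Permutation.Setoid.Properties using (Unique-resp-↭)
open import Data.List.Relation.Binary.Pointwise as Pointwise using (Pointwise; []; _∷_)
open import Data.List.Relation.Unary.All as All using (All; []; _∷_)
open import Data.List.Relation.Unary.All.Properties as All using (all-upTo)
open import Data.List.Relation.Unary.AllPairs as AllPairs using (AllPairs; []; _∷_)
open import Data.List.Relation.Unary.AllPairs.Properties as AllPairs using (filter⁺)
open import Data.List.Relation.Unary.Any using (here; there)
open import Data.List.Relation.Unary.Unique.Propositional.Properties using (upTo⁺)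
open import Data.Maybe.Base using (just)
open import Data.Nat.Base using (ℕ; zero; suc; _+_; _≤_; _<_)
open import Data.Nat.Properties
  using (_≟_; _<?_; _≤?_; suc-injective; +-suc; +-identityʳ; ≤-refl; ≤-reflexive; ≤-trans;
         ≤-totalOrder; <-irrefl; <-trans; <-≤-trans; ≤-<-trans; <⇒≤; <⇒≱; n≤1+n; m≤n⇒m<n∨m≡n;
         <-resp₂-≡)
open import Data.List.Extrema ≤-totalOrder
  using (argmin; argmax; argmin-sel; argmax-sel; f[argmin]≤f[⊤]; f[argmin]≤f[xs]; f[⊥]≤f[argmax];
         f[xs]≤f[argmax])
open import Data.Product.Base using (_×_; _,_; ∃-syntax; ∃₂; proj₁; proj₂)
open import Data.Sum.Base as Sum using (_⊎_; inj₁; inj₂; [_,_]′)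
open import Data.Tree.Binary using (leaf; node; #nodes; mapₙ; module Infix; module Leaves)
import Data.Tree.Binary.Relation.Unary.All as TreeAll
open import Function.Base using (_∘_; id; flip; case_of_)
open import Level using (0ℓ)
open import Relation.Binary.Construct.Closure.ReflexiveTransitive as Star using (ε; _◅_; _◅◅_)
open import Relation.Binary.Core using (Rel)
open import Relation.Binary.Definitions using (Decidable)
open import Relation.Binary.PropositionalEquality as ≡ using (_≡_; _≢_; refl; cong; cong₂; subst)
open import Relation.Nullary using (¬_; ¬?; yes; no)
open import Relation.Nullary.Decidable using (does; dec-true; dec-false)
open import Relation.Unary as Unary using (Pred; U; _∩_)

-- Lists with one entry removed

private
  variable
    A B : Set
    x y z : A
    xs ys zs : List A

AllPairs-++⁻ : {R : Rel A 0ℓ} → ∀ xs → AllPairs R (xs ++ ys) →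
  AllPairs R xs × AllPairs R ys × (∀ {x y} → x ∈ xs → y ∈ ys → R x y)
AllPairs-++⁻ []       ps = [] , ps , λ ()
AllPairs-++⁻ (x ∷ xs) (p ∷ ps) with AllPairs-++⁻ xs ps
... | qs , rs , cross =
  All.++⁻ˡ xs p ∷ qs , rs ,
  λ { (here refl) y∈ → All.lookup (All.++⁻ʳ xs p) y∈ ; (there x∈) → cross x∈ }

-- The order of the remaining entries is kept. Deleting a childless node of a tree and deleting a
-- root of a forest both act on inorder lists in this way.
data Removal (x : A) : List A → List A → Set where
  here  : Removal x (x ∷ xs) xs
  there : Removal x xs ys → Removal x (y ∷ xs) (y ∷ ys)

removal-++ˡ : Removal x xs ys → Removal x (xs ++ zs) (ys ++ zs)
removal-++ˡ here      = here
removal-++ˡ (there ρ) = there (removal-++ˡ ρ)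

removal-++ʳ : ∀ zs → Removal x xs ys → Removal x (zs ++ xs) (zs ++ ys)
removal-++ʳ []       ρ = ρ
removal-++ʳ (_ ∷ zs) ρ = there (removal-++ʳ zs ρ)

removal-mid : ∀ xs → Removal x (xs ++ x ∷ ys) (xs ++ ys)
removal-mid xs = removal-++ʳ xs here

removal-↭ : Removal x xs ys → xs ↭ x ∷ ys
removal-↭ here      = ↭-refl
removal-↭ (there ρ) = ↭-trans (prep _ (removal-↭ ρ)) (↭-swap _ _ ↭-refl)

removal-length : Removal x xs ys → length xs ≡ suc (length ys)
removal-length here      = refl
removal-length (there ρ) = cong suc (removal-length ρ)

removal-∈ : Removal x xs ys → x ∈ xs
removal-∈ here      = here refl
removal-∈ (there ρ) = there (removal-∈ ρ)

removal-⊆ : Removal x xs ys → y ∈ ys → y ∈ xs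
removal-⊆ here      y∈         = there y∈
removal-⊆ (there ρ) (here y≡)  = here y≡
removal-⊆ (there ρ) (there y∈) = there (removal-⊆ ρ y∈)

removal-keeps : Removal x xs ys → y ≢ x → y ∈ xs → y ∈ ys
removal-keeps here      y≢ (here y≡)  = ⊥-elim (y≢ y≡)
removal-keeps here      y≢ (there y∈) = y∈
removal-keeps (there ρ) y≢ (here y≡)  = here y≡
removal-keeps (there ρ) y≢ (there y∈) = there (removal-keeps ρ y≢ y∈)

removal-AllPairs : {R : Rel A 0ℓ} → Removal x xs ys → AllPairs R xs → AllPairs R ys
removal-AllPairs here      (_ ∷ ps) = ps
removal-AllPairs (there ρ) (p ∷ ps) =
  All.tabulate (All.lookup p ∘ removal-⊆ ρ) ∷ removal-AllPairs ρ ps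

-- Sorted inorder lists

nodes : BTree A → List A
nodes (leaf _)     = []
nodes (node l x r) = nodes l ++ x ∷ nodes r

infix 4 _<ᴺ_

-- Labels may repeat, so strictness comes from the indices. The labels are carried along because an
-- exchange of nodes must give an exchange of letters in `≤ᴾ-swap`.
record _<ᴺ_ (x y : Node) : Set where
  constructor _,_
  field
    index< : proj₁ x < proj₁ y
    label≤ : proj₂ x ≤ proj₂ y

open _<ᴺ_

<ᴺ-trans : ∀ {x y z} → x <ᴺ y → y <ᴺ z → x <ᴺ z
<ᴺ-trans (i<j , a≤b) (j<k , b≤c) = <-trans i<j j<k , ≤-trans a≤b b≤c

<ᴺ-irrefl : ∀ {x} → ¬ x <ᴺ x
<ᴺ-irrefl (i<i , _) = <-irrefl refl i<i

<ᴺ-asym : ∀ {x y} → x <ᴺ y → ¬ y <ᴺ x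
<ᴺ-asym x<y y<x = <ᴺ-irrefl (<ᴺ-trans x<y y<x)

Sorted : List Node → Set
Sorted = AllPairs _<ᴺ_

compare : ∀ {x y xs} → Sorted xs → x ∈ xs → y ∈ xs → x ≡ y ⊎ x <ᴺ y ⊎ y <ᴺ x
compare (p ∷ ps) (here refl) (here refl) = inj₁ refl
compare (p ∷ ps) (here refl) (there y∈)  = inj₂ (inj₁ (All.lookup p y∈))
compare (p ∷ ps) (there x∈)  (here refl) = inj₂ (inj₂ (All.lookup p x∈))
compare (p ∷ ps) (there x∈)  (there y∈)  = compare ps x∈ y∈

index-injective : ∀ {x y xs} → Sorted xs → x ∈ xs → y ∈ xs → proj₁ x ≡ proj₁ y → x ≡ y
index-injective s x∈ y∈ eq with compare s x∈ y∈
... | inj₁ x≡y               = x≡y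
... | inj₂ (inj₁ (i<j , _)) = ⊥-elim (<-irrefl eq i<j)
... | inj₂ (inj₂ (j<i , _)) = ⊥-elim (<-irrefl (≡.sym eq) j<i)

-- A sorted list has no repetitions. This keeps the inorder lists of the forest and of the tree
-- equal when both lose the same node.
removal-functional : ∀ {x xs ys zs} → Sorted xs → Removal x xs ys → Removal x xs zs → ys ≡ zs
removal-functional _        here      here      = refl
removal-functional (p ∷ _)  here      (there σ) = ⊥-elim (<ᴺ-irrefl (All.lookup p (removal-∈ σ)))
removal-functional (p ∷ _)  (there ρ) here      = ⊥-elim (<ᴺ-irrefl (All.lookup p (removal-∈ ρ)))
removal-functional (_ ∷ ps) (there ρ) (there σ) = cong (_ ∷_) (removal-functional ps ρ σ)

data Location (y : A) (xs : List A) (x : A) (ys : List A) : Set where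
  before : y ∈ xs → Location y xs x ys
  at     : y ≡ x → Location y xs x ys
  after  : y ∈ ys → Location y xs x ys

locate : ∀ xs → y ∈ xs ++ x ∷ ys → Location y xs x ys
locate xs y∈ with ∈-++⁻ xs y∈
... | inj₁ y∈xs         = before y∈xs
... | inj₂ (here y≡x)   = at y≡x
... | inj₂ (there y∈ys) = after y∈ys

∈-before : y ∈ xs → y ∈ xs ++ x ∷ ys
∈-before = ∈-++⁺ˡ

∈-at : ∀ xs → x ∈ xs ++ x ∷ ys
∈-at xs = ∈-++⁺ʳ xs (here refl)

∈-after : ∀ xs → y ∈ ys → y ∈ xs ++ x ∷ ys
∈-after xs = ∈-++⁺ʳ xs ∘ there

record SortedAround (xs : List Node) (x : Node) (ys : List Node) : Set where
  field
    sortedˡ : Sorted xs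
    sortedʳ : Sorted ys
    <mid    : ∀ {y} → y ∈ xs → y <ᴺ x
    mid<    : ∀ {y} → y ∈ ys → x <ᴺ y

  before<after : ∀ {y z} → y ∈ xs → z ∈ ys → y <ᴺ z
  before<after y∈ z∈ = <ᴺ-trans (<mid y∈) (mid< z∈)

sortedAround : ∀ {x ys} xs → Sorted (xs ++ x ∷ ys) → SortedAround xs x ys
sortedAround xs s with AllPairs-++⁻ xs s
... | sˡ , p ∷ sʳ , cross = record
  { sortedˡ = sˡ
  ; sortedʳ = sʳ
  ; <mid    = λ y∈ → cross y∈ (here refl)
  ; mid<    = All.lookup p
  }

module Around {x : Node} {ys : List Node} (xs : List Node) (s : Sorted (xs ++ x ∷ ys)) =
  SortedAround (sortedAround xs s)

-- Ancestors

data Above {A : Set} : BTree A → A → A → Set where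
  topˡ : ∀ {l x r y}   → y ∈ nodes l → Above (node l x r) x y
  topʳ : ∀ {l x r y}   → y ∈ nodes r → Above (node l x r) x y
  inˡ  : ∀ {l x r y z} → Above l y z → Above (node l x r) y z
  inʳ  : ∀ {l x r y z} → Above r y z → Above (node l x r) y z

above-∈ˡ : ∀ {t : BTree A} → Above t x y → x ∈ nodes t
above-∈ˡ (topˡ {l = l} _) = ∈-at (nodes l)
above-∈ˡ (topʳ {l = l} _) = ∈-at (nodes l)
above-∈ˡ (inˡ a)          = ∈-before (above-∈ˡ a)
above-∈ˡ (inʳ {l = l} a)  = ∈-after (nodes l) (above-∈ˡ a)

above-∈ʳ : ∀ {t : BTree A} → Above t x y → y ∈ nodes t
above-∈ʳ (topˡ y∈)         = ∈-before y∈
above-∈ʳ (topʳ {l = l} y∈) = ∈-after (nodes l) y∈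
above-∈ʳ (inˡ a)           = ∈-before (above-∈ʳ a)
above-∈ʳ (inʳ {l = l} a)   = ∈-after (nodes l) (above-∈ʳ a)

root-maximal : ∀ {l x r y} → Sorted (nodes (node l x r)) → ¬ Above (node l x r) y x
root-maximal {l} s = λ where
    (topˡ x∈) → <ᴺ-irrefl (<mid x∈)
    (topʳ x∈) → <ᴺ-irrefl (mid< x∈)
    (inˡ a)   → <ᴺ-irrefl (<mid (above-∈ʳ a))
    (inʳ a)   → <ᴺ-irrefl (mid< (above-∈ʳ a))
  where open Around (nodes l) s

above-asym : ∀ {t x y} → Sorted (nodes t) → Above t x y → ¬ Above t y x
above-asym s (topˡ _) b = root-maximal s b
above-asym s (topʳ _) b = root-maximal s b
above-asym s a@(inˡ _) (topˡ _) = root-maximal s a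
above-asym s a@(inˡ _) (topʳ _) = root-maximal s a
above-asym s a@(inʳ _) (topˡ _) = root-maximal s a
above-asym s a@(inʳ _) (topʳ _) = root-maximal s a
above-asym s (inˡ {l = l} a) (inˡ b) = above-asym (Around.sortedˡ (nodes l) s) a b
above-asym s (inʳ {l = l} a) (inʳ b) = above-asym (Around.sortedʳ (nodes l) s) a b
above-asym s (inˡ {l = l} a) (inʳ b) =
  <ᴺ-irrefl (Around.before<after (nodes l) s (above-∈ˡ a) (above-∈ʳ b))
above-asym s (inʳ {l = l} a) (inˡ b) =
  <ᴺ-irrefl (Around.before<after (nodes l) s (above-∈ˡ b) (above-∈ʳ a))

-- Both orientations are kept in one type so that convexity serves descendants on either side of
-- `y`, and ExtractMin as well as ExtractMax.
data Between (y w z : Node) : Set where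
  up   : y <ᴺ w → w <ᴺ z → Between y w z
  down : z <ᴺ w → w <ᴺ y → Between y w z

between-irrefl : ∀ {y z} → ¬ Between y y z
between-irrefl (up y<y _)   = <ᴺ-irrefl y<y
between-irrefl (down _ y<y) = <ᴺ-irrefl y<y

between-¬> : ∀ {y w z} → Between y w z → y <ᴺ w → ¬ z <ᴺ w
between-¬> (up _ w<z)   _   z<w = <ᴺ-asym w<z z<w
between-¬> (down _ w<y) y<w _   = <ᴺ-asym w<y y<w

between-¬< : ∀ {y w z} → Between y w z → w <ᴺ y → ¬ w <ᴺ z
between-¬< (up y<w _)   w<y _   = <ᴺ-asym y<w w<y
between-¬< (down z<w _) _   w<z = <ᴺ-asym z<w w<z

-- A node and its descendants fill an interval of the inorder list. In the induction, if `y` and `z`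
-- lie in one subtree, a node outside it is on the same side of both and so not between them.
above-between : ∀ {t y w z} → Sorted (nodes t) → Above t y z → w ∈ nodes t → Between y w z → Above t y w
above-between {node l x r} s a w∈ b with a | locate (nodes l) w∈
... | topˡ _ | before w∈l = topˡ w∈l
... | topˡ _ | after w∈r  = topʳ w∈r
... | topʳ _ | before w∈l = topˡ w∈l
... | topʳ _ | after w∈r  = topʳ w∈r
... | topˡ _ | at refl    = ⊥-elim (between-irrefl b)
... | topʳ _ | at refl    = ⊥-elim (between-irrefl b)
... | inˡ a′ | before w∈l = inˡ (above-between (Around.sortedˡ (nodes l) s) a′ w∈l b)
... | inʳ a′ | after w∈r  = inʳ (above-between (Around.sortedʳ (nodes l) s) a′ w∈r b)
... | inˡ a′ | at refl    = ⊥-elim (between-¬> b (<mid (above-∈ˡ a′)) (<mid (above-∈ʳ a′)))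
  where open Around (nodes l) s
... | inˡ a′ | after w∈r  = ⊥-elim (between-¬> b
  (before<after (above-∈ˡ a′) w∈r) (before<after (above-∈ʳ a′) w∈r))
  where open Around (nodes l) s
... | inʳ a′ | at refl    = ⊥-elim (between-¬< b (mid< (above-∈ˡ a′)) (mid< (above-∈ʳ a′)))
  where open Around (nodes l) s
... | inʳ a′ | before w∈l = ⊥-elim (between-¬< b
  (before<after w∈l (above-∈ˡ a′)) (before<after w∈l (above-∈ʳ a′)))
  where open Around (nodes l) s

-- Childless nodes and inorder neighbours

data Childless (x : Node) : BTree Node → Set where
  root : Childless x (node ∙ x ∙)
  inˡ  : ∀ {l y r} → x ∈ childless l → Childless x (node l y r)
  inʳ  : ∀ {l y r} → x ∈ childless r → Childless x (node l y r)

childless-view : ∀ {x} t → x ∈ childless t → Childless x t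
childless-view (node (leaf _) y (leaf _))     (here refl) = root
childless-view (node (leaf _) y (node _ _ _)) x∈          = inʳ x∈
childless-view (node l@(node _ _ _) y r)      x∈ with ∈-++⁻ (childless l) x∈
... | inj₁ x∈l = inˡ x∈l
... | inj₂ x∈r = inʳ x∈r

childless-⊆ : ∀ {x} t → x ∈ childless t → x ∈ nodes t
childless-⊆ t@(node l _ r) x∈ with childless-view t x∈
... | root    = here refl
... | inˡ x∈l = ∈-before (childless-⊆ l x∈l)
... | inʳ x∈r = ∈-after (nodes l) (childless-⊆ r x∈r)

childlessˡ : ∀ {x y} l r → x ∈ childless l → x ∈ childless (node l y r)
childlessˡ (node _ _ _) r x∈ = ∈-++⁺ˡ x∈

childlessʳ : ∀ {x y} l r → x ∈ childless r → x ∈ childless (node l y r)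
childlessʳ (leaf _)       (node _ _ _) x∈ = x∈
childlessʳ l@(node _ _ _) (node _ _ _) x∈ = ∈-++⁺ʳ (childless l) x∈

-- Adjacency is expressed by an empty gap and not by positions, which makes it easy to compare
-- before and after a deletion.
record Neighbours (ns : List Node) (y z : Node) : Set where
  field
    y∈  : y ∈ ns
    z∈  : z ∈ ns
    y<z : y <ᴺ z
    gap : ∀ {w} → w ∈ ns → y <ᴺ w → ¬ w <ᴺ z

-- The predecessor of a node with a left child is the last node of its left subtree, and dually for
-- the successor. Thus an obstruction to removing a node of `t` is visible at an inorder neighbour,
-- where twinness speaks.
data Child (t : BTree Node) (x : Node) : Set where
  none : x ∈ childless t → Child t x
  pred : ∀ {y} → Neighbours (nodes t) y x → Above t x y → Child t x
  succ : ∀ {y} → Neighbours (nodes t) x y → Above t x y → Child t x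

neighboursˡ : ∀ {xs x ys y z} → Sorted (xs ++ x ∷ ys) → Neighbours xs y z → Neighbours (xs ++ x ∷ ys) y z
neighboursˡ {xs} s nb = record
  { y∈ = ∈-before y∈ ; z∈ = ∈-before z∈ ; y<z = y<z
  ; gap = λ w∈ y<w w<z → case-gap (locate xs w∈) y<w w<z }
  where
  open Neighbours nb
  open Around xs s
  case-gap : ∀ {w} → Location w xs _ _ → _ <ᴺ w → ¬ w <ᴺ _
  case-gap (before w∈)  y<w w<z = gap w∈ y<w w<z
  case-gap (at refl)    _   w<z = <ᴺ-asym w<z (<mid z∈)
  case-gap (after w∈)   _   w<z = <ᴺ-asym w<z (before<after z∈ w∈)

neighboursʳ : ∀ {x ys y z} xs → Sorted (xs ++ x ∷ ys) → Neighbours ys y z → Neighbours (xs ++ x ∷ ys) y z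
neighboursʳ xs s nb = record
  { y∈ = ∈-after xs y∈ ; z∈ = ∈-after xs z∈ ; y<z = y<z
  ; gap = λ w∈ y<w w<z → case-gap (locate xs w∈) y<w w<z }
  where
  open Neighbours nb
  open Around xs s
  case-gap : ∀ {w} → Location w xs _ _ → _ <ᴺ w → ¬ w <ᴺ _
  case-gap (after w∈)   y<w w<z = gap w∈ y<w w<z
  case-gap (at refl)    y<w _   = <ᴺ-asym y<w (mid< y∈)
  case-gap (before w∈)  y<w _   = <ᴺ-asym y<w (before<after w∈ y∈)

last-neighbour : ∀ {x ys} xs → xs ≢ [] → Sorted (xs ++ x ∷ ys) →
  ∃[ y ] y ∈ xs × Neighbours (xs ++ x ∷ ys) y x
last-neighbour []           xs≢[] s = ⊥-elim (xs≢[] refl)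
last-neighbour (y ∷ [])     _     (p ∷ ps) = y , here refl , record
  { y∈ = here refl ; z∈ = there (here refl) ; y<z = All.lookup p (here refl)
  ; gap = λ { (here refl) y<y _ → <ᴺ-irrefl y<y
            ; (there (here refl)) _ x<x → <ᴺ-irrefl x<x
            ; (there (there w∈)) _ w<x → <ᴺ-asym w<x (Around.mid< [] ps w∈) } }
last-neighbour (x ∷ xs@(_ ∷ _)) _ s@(p ∷ ps) with last-neighbour xs (λ ()) ps
... | y , y∈ , nb = y , there y∈ , record
  { y∈ = there (Neighbours.y∈ nb) ; z∈ = there (Neighbours.z∈ nb) ; y<z = Neighbours.y<z nb
  ; gap = λ { (here refl) y<x _ → <ᴺ-asym y<x (All.lookup p (∈-before y∈))
            ; (there w∈) → Neighbours.gap nb w∈ } }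

first-neighbour : ∀ {x y ys} xs → Sorted (xs ++ x ∷ y ∷ ys) → Neighbours (xs ++ x ∷ y ∷ ys) x y
first-neighbour xs s = record
  { y∈ = ∈-at xs ; z∈ = ∈-after xs (here refl) ; y<z = mid< (here refl)
  ; gap = λ w∈ x<w w<y → case-gap (locate xs w∈) x<w w<y }
  where
  open Around xs s
  case-gap : ∀ {w} → Location w xs _ _ → _ <ᴺ w → ¬ w <ᴺ _
  case-gap (before w∈)          x<w _   = <ᴺ-asym x<w (<mid w∈)
  case-gap (at refl)            x<w _   = <ᴺ-irrefl x<w
  case-gap (after (here refl))  _   w<y = <ᴺ-irrefl w<y
  case-gap (after (there w∈))   _   w<y with sortedʳ
  ... | p ∷ _ = <ᴺ-asym w<y (All.lookup p w∈)

nodes-∷ : ∀ l (x : A) r → ∃₂ λ y ys → nodes (node l x r) ≡ y ∷ ys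
nodes-∷ (leaf _)     x r = x , nodes r , refl
nodes-∷ (node l y m) x r with nodes-∷ l y m
... | z , zs , eq = z , zs ++ x ∷ nodes r , cong (_++ x ∷ nodes r) eq

nodes-≢[] : ∀ l (x : A) r → nodes (node l x r) ≢ []
nodes-≢[] l x r eq with nodes-∷ l x r
... | y , ys , eq′ with () ← ≡.trans (≡.sym eq) eq′

root-child : ∀ l x r → Sorted (nodes (node l x r)) → Child (node l x r) x
root-child (leaf _) x (leaf _) s = none (here refl)
root-child l@(node ll y lr) x (leaf _) s with last-neighbour (nodes l) (nodes-≢[] ll y lr) s
... | z , z∈ , nb = pred nb (topˡ z∈)
root-child l x r@(node rl y rr) s with nodes-∷ rl y rr
... | z , zs , eq = succ
  (subst (λ ns → Neighbours (nodes l ++ x ∷ ns) x z) (≡.sym eq)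
    (first-neighbour (nodes l) (subst (λ ns → Sorted (nodes l ++ x ∷ ns)) eq s)))
  (topʳ (subst (z ∈_) (≡.sym eq) (here refl)))

child : ∀ {x} t → Sorted (nodes t) → x ∈ nodes t → Child t x
child (node l y r) s x∈ with locate (nodes l) x∈
... | at refl = root-child l y r s
... | before x∈l with child l (Around.sortedˡ (nodes l) s) x∈l
...   | none c    = none (childlessˡ l r c)
...   | pred nb a = pred (neighboursˡ s nb) (inˡ a)
...   | succ nb a = succ (neighboursˡ s nb) (inˡ a)
child (node l y r) s x∈ | after x∈r with child r (Around.sortedʳ (nodes l) s) x∈r
...   | none c    = none (childlessʳ l r c)
...   | pred nb a = pred (neighboursʳ (nodes l) s nb) (inʳ a)
...   | succ nb a = succ (neighboursʳ (nodes l) s nb) (inʳ a)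

-- Deleting a childless node

data Prune (x : Node) : BTree Node → BTree Node → Set where
  here : Prune x (node ∙ x ∙) ∙
  inˡ  : ∀ {l l′ y r} → Prune x l l′ → Prune x (node l y r) (node l′ y r)
  inʳ  : ∀ {l y r r′} → Prune x r r′ → Prune x (node l y r) (node l y r′)

suppressChildless-∉ : ∀ {i} t → (∀ {y} → y ∈ nodes t → i ≢ proj₁ y) → suppressChildless i t ≡ t
suppressChildless-∉ (leaf _) i∉ = refl
suppressChildless-∉ {i} (node l (j , a) r) i∉
  rewrite dec-false (i ≟ j) (i∉ (∈-at (nodes l))) =
  cong₂ (λ l r → node l (j , a) r)
    (suppressChildless-∉ l (i∉ ∘ ∈-before)) (suppressChildless-∉ r (i∉ ∘ ∈-after (nodes l)))

suppressChildless-ˡ : ∀ {x l y r} → Sorted (nodes (node l y r)) → x ∈ nodes l →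
  suppressChildless (proj₁ x) (node l y r) ≡ node (suppressChildless (proj₁ x) l) y r
suppressChildless-ˡ {x} {l} {y} {r} s x∈
  rewrite dec-false (proj₁ x ≟ proj₁ y) (λ eq → <-irrefl eq (index< (Around.<mid (nodes l) s x∈))) =
  cong (node _ y) (suppressChildless-∉ r λ z∈ eq →
    <-irrefl eq (index< (Around.before<after (nodes l) s x∈ z∈)))

suppressChildless-ʳ : ∀ {x l y r} → Sorted (nodes (node l y r)) → x ∈ nodes r →
  suppressChildless (proj₁ x) (node l y r) ≡ node l y (suppressChildless (proj₁ x) r)
suppressChildless-ʳ {x} {l} {y} {r} s x∈
  rewrite dec-false (proj₁ x ≟ proj₁ y) (λ eq → <-irrefl (≡.sym eq) (index< (Around.mid< (nodes l) s x∈))) =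
  cong (λ l → node l y _) (suppressChildless-∉ l λ z∈ eq →
    <-irrefl (≡.sym eq) (index< (Around.before<after (nodes l) s z∈ x∈)))

-- `suppressChildless` searches both subtrees. Indices are distinct, so it changes only the one on
-- the path to `x` that `Prune` records.
prune : ∀ {x} t → Sorted (nodes t) → x ∈ childless t → Prune x t (suppressChildless (proj₁ x) t)
prune {x} t@(node l y r) s x∈ with childless-view t x∈
... | root rewrite dec-true (proj₁ x ≟ proj₁ x) refl = here
... | inˡ x∈l = subst (Prune x t) (≡.sym (suppressChildless-ˡ {l = l} {r = r} s (childless-⊆ l x∈l)))
  (inˡ (prune l (Around.sortedˡ (nodes l) s) x∈l))
... | inʳ x∈r = subst (Prune x t) (≡.sym (suppressChildless-ʳ {l = l} {r = r} s (childless-⊆ r x∈r)))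
  (inʳ (prune r (Around.sortedʳ (nodes l) s) x∈r))

prune-removal : ∀ {x t t′} → Prune x t t′ → Removal x (nodes t) (nodes t′)
prune-removal here            = here
prune-removal (inˡ p)         = removal-++ˡ (prune-removal p)
prune-removal (inʳ {l = l} p) = removal-++ʳ (nodes l) (there (prune-removal p))

prune-above : ∀ {x t t′ y z} → Prune x t t′ → Above t′ y z → Above t y z
prune-above (inˡ p) (topˡ z∈) = topˡ (removal-⊆ (prune-removal p) z∈)
prune-above (inˡ p) (topʳ z∈) = topʳ z∈
prune-above (inˡ p) (inˡ a)   = inˡ (prune-above p a)
prune-above (inˡ p) (inʳ a)   = inʳ a
prune-above (inʳ p) (topʳ z∈) = topʳ (removal-⊆ (prune-removal p) z∈)
prune-above (inʳ p) (topˡ z∈) = topˡ z∈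
prune-above (inʳ p) (inʳ a)   = inʳ (prune-above p a)
prune-above (inʳ p) (inˡ a)   = inˡ a

-- Pruning destroys only pairs whose descendant is `x`, since a childless node is above nothing.
-- Dually, `uproot-keeps-above` loses only pairs whose ancestor is `x`.
prune-keeps-above : ∀ {x t t′ y z} → Prune x t t′ → z ≢ x → Above t y z → Above t′ y z
prune-keeps-above (inˡ p) z≢ (topˡ z∈) = topˡ (removal-keeps (prune-removal p) z≢ z∈)
prune-keeps-above (inˡ p) z≢ (topʳ z∈) = topʳ z∈
prune-keeps-above (inˡ p) z≢ (inˡ a)   = inˡ (prune-keeps-above p z≢ a)
prune-keeps-above (inˡ p) z≢ (inʳ a)   = inʳ a
prune-keeps-above (inʳ p) z≢ (topʳ z∈) = topʳ (removal-keeps (prune-removal p) z≢ z∈)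
prune-keeps-above (inʳ p) z≢ (topˡ z∈) = topˡ z∈
prune-keeps-above (inʳ p) z≢ (inʳ a)   = inʳ (prune-keeps-above p z≢ a)
prune-keeps-above (inʳ p) z≢ (inˡ a)   = inˡ a
prune-keeps-above here    z≢ (topˡ ())
prune-keeps-above here    z≢ (topʳ ())
prune-keeps-above here    z≢ (inˡ ())
prune-keeps-above here    z≢ (inʳ ())

pruned-minimal : ∀ {x t t′ z} → Sorted (nodes t) → Prune x t t′ → ¬ Above t x z
pruned-minimal s here    (topˡ ())
pruned-minimal s here    (topʳ ())
pruned-minimal s here    (inˡ ())
pruned-minimal s here    (inʳ ())
pruned-minimal {t = node l _ _} s (inˡ p) = λ where
    (topˡ _) → <ᴺ-irrefl (<mid x∈)
    (topʳ _) → <ᴺ-irrefl (<mid x∈)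
    (inˡ a)  → pruned-minimal sortedˡ p a
    (inʳ a)  → <ᴺ-irrefl (before<after x∈ (above-∈ˡ a))
  where
  open Around (nodes l) s
  x∈ = removal-∈ (prune-removal p)
pruned-minimal {t = node l _ _} s (inʳ p) = λ where
    (topˡ _) → <ᴺ-irrefl (mid< x∈)
    (topʳ _) → <ᴺ-irrefl (mid< x∈)
    (inʳ a)  → pruned-minimal sortedʳ p a
    (inˡ a)  → <ᴺ-irrefl (before<after (above-∈ˡ a) x∈)
  where
  open Around (nodes l) s
  x∈ = removal-∈ (prune-removal p)

-- Forests

nodesᶠ : Forest → List Node
nodesᶠ []               = []
nodesᶠ (tree l x r ∷ F) = nodes (node l x r) ++ nodesᶠ F

data Aboveᶠ : Forest → Node → Node → Set where
  here  : ∀ {l x r F y z} → Above (node l x r) y z → Aboveᶠ (tree l x r ∷ F) y z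
  there : ∀ {t F y z} → Aboveᶠ F y z → Aboveᶠ (t ∷ F) y z

plant-nodes : ∀ t {F} → nodesᶠ (plant t F) ≡ nodes t ++ nodesᶠ F
plant-nodes (leaf _)     = refl
plant-nodes (node _ _ _) = refl

plant-hereᶠ : ∀ {t F y z} → Above t y z → Aboveᶠ (plant t F) y z
plant-hereᶠ {node _ _ _} a = here a

plant-thereᶠ : ∀ t {F y z} → Aboveᶠ F y z → Aboveᶠ (plant t F) y z
plant-thereᶠ (leaf _)     a = a
plant-thereᶠ (node _ _ _) a = there a

plant-aboveᶠ : ∀ t {F y z} → Aboveᶠ (plant t F) y z → Above t y z ⊎ Aboveᶠ F y z
plant-aboveᶠ (leaf _)     a         = inj₂ a
plant-aboveᶠ (node _ _ _) (here a)  = inj₁ a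
plant-aboveᶠ (node _ _ _) (there a) = inj₂ a

aboveᶠ-∈ˡ : ∀ {F y z} → Aboveᶠ F y z → y ∈ nodesᶠ F
aboveᶠ-∈ˡ (here a)                  = ∈-++⁺ˡ (above-∈ˡ a)
aboveᶠ-∈ˡ (there {tree l x r} a) = ∈-++⁺ʳ (nodes (node l x r)) (aboveᶠ-∈ˡ a)

aboveᶠ-∈ʳ : ∀ {F y z} → Aboveᶠ F y z → z ∈ nodesᶠ F
aboveᶠ-∈ʳ (here a)                  = ∈-++⁺ˡ (above-∈ʳ a)
aboveᶠ-∈ʳ (there {tree l x r} a) = ∈-++⁺ʳ (nodes (node l x r)) (aboveᶠ-∈ʳ a)

roots-⊆ : ∀ {x} F → x ∈ roots F → x ∈ nodesᶠ F
roots-⊆ (tree l _ r ∷ F) (here refl) = ∈-++⁺ˡ (∈-at (nodes l))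
roots-⊆ (tree l x r ∷ F) (there x∈)  = ∈-++⁺ʳ (nodes (node l x r)) (roots-⊆ F x∈)

-- The trees of the forest occupy consecutive intervals, so a node between two nodes of one tree
-- lies in that tree, where `above-between` applies.
aboveᶠ-between : ∀ {F y w z} → Sorted (nodesᶠ F) → Aboveᶠ F y z → w ∈ nodesᶠ F → Between y w z → Aboveᶠ F y w
aboveᶠ-between {tree l x r ∷ F} s a w∈ b
  with AllPairs-++⁻ (nodes (node l x r)) s | a | ∈-++⁻ (nodes (node l x r)) w∈
... | sˡ , _  , _     | here a′  | inj₁ w∈ˡ = here (above-between sˡ a′ w∈ˡ b)
... | _  , sʳ , _     | there a′ | inj₂ w∈ʳ = there (aboveᶠ-between sʳ a′ w∈ʳ b)
... | _  , _  , cross | here a′  | inj₂ w∈ʳ =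
  ⊥-elim (between-¬> b (cross (above-∈ˡ a′) w∈ʳ) (cross (above-∈ʳ a′) w∈ʳ))
... | _  , _  , cross | there a′ | inj₁ w∈ˡ =
  ⊥-elim (between-¬< b (cross w∈ˡ (aboveᶠ-∈ˡ a′)) (cross w∈ˡ (aboveᶠ-∈ʳ a′)))

root-or-below : ∀ {x} F → x ∈ nodesᶠ F → x ∈ roots F ⊎ ∃[ y ] Aboveᶠ F y x
root-or-below (tree l y r ∷ F) x∈ with ∈-++⁻ (nodes (node l y r)) x∈
... | inj₁ x∈t with locate (nodes l) x∈t
...   | before x∈l = inj₂ (y , here (topˡ x∈l))
...   | at refl    = inj₁ (here refl)
...   | after x∈r  = inj₂ (y , here (topʳ x∈r))
root-or-below (tree l y r ∷ F) x∈ | inj₂ x∈F with root-or-below F x∈F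
...   | inj₁ x∈roots = inj₁ (there x∈roots)
...   | inj₂ (z , a) = inj₂ (z , there a)

rootᶠ-maximal : ∀ {F x z} → Sorted (nodesᶠ F) → x ∈ roots F → ¬ Aboveᶠ F z x
rootᶠ-maximal {tree l y r ∷ F} s x∈ a with AllPairs-++⁻ (nodes (node l y r)) s | x∈ | a
... | sˡ , _  , _     | here refl | here a′  = root-maximal sˡ a′
... | _  , _  , cross | here refl | there a′ = <ᴺ-irrefl (cross (∈-at (nodes l)) (aboveᶠ-∈ʳ a′))
... | _  , _  , cross | there x∈′ | here a′  = <ᴺ-irrefl (cross (above-∈ʳ a′) (roots-⊆ F x∈′))
... | _  , sʳ , _     | there x∈′ | there a′ = rootᶠ-maximal sʳ x∈′ a′

aboveᶠ-irrefl : ∀ {F x} → Sorted (nodesᶠ F) → ¬ Aboveᶠ F x x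
aboveᶠ-irrefl {tree l y r ∷ F} s a with AllPairs-++⁻ (nodes (node l y r)) s | a
... | sˡ , _  , _ | here a′  = above-asym sˡ a′ a′
... | _  , sʳ , _ | there a′ = aboveᶠ-irrefl sʳ a′

data Uproot (x : Node) : Forest → Forest → Set where
  here  : ∀ {l r F} → Uproot x (tree l x r ∷ F) (plant l (plant r F))
  there : ∀ {t F F′} → Uproot x F F′ → Uproot x (t ∷ F) (t ∷ F′)

uproot : ∀ {x} F → Sorted (nodesᶠ F) → x ∈ roots F → Uproot x F (suppressRoot (proj₁ x) F)
uproot {i , _} (tree l _ r ∷ F) s (here refl)
  rewrite dec-true (i ≟ i) refl = here
uproot {x} (tree l y r ∷ F) s (there x∈) with AllPairs-++⁻ (nodes (node l y r)) s
... | _ , sʳ , cross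
  rewrite dec-false (proj₁ x ≟ proj₁ y)
    (λ eq → <-irrefl (≡.sym eq) (index< (cross (∈-at (nodes l)) (roots-⊆ F x∈)))) =
  there (uproot F sʳ x∈)

-- The subtrees are planted where their root stood, so the inorder list loses the root and keeps its
-- order.
uproot-removal : ∀ {x F F′} → Uproot x F F′ → Removal x (nodesᶠ F) (nodesᶠ F′)
uproot-removal {x} (here {l} {r} {F})
  rewrite plant-nodes l {plant r F} | plant-nodes r {F} | ++-assoc (nodes l) (x ∷ nodes r) (nodesᶠ F) =
  removal-mid (nodes l)
uproot-removal (there {tree l x r} u) = removal-++ʳ (nodes (node l x r)) (uproot-removal u)

uproot-above : ∀ {x F F′ y z} → Uproot x F F′ → Aboveᶠ F′ y z → Aboveᶠ F y z
uproot-above (here {l} {r} {F}) a with plant-aboveᶠ l a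
... | inj₁ a′ = here (inˡ a′)
... | inj₂ a′ with plant-aboveᶠ r a′
...   | inj₁ a″ = here (inʳ a″)
...   | inj₂ a″ = there a″
uproot-above (there u) (here a)  = here a
uproot-above (there u) (there a) = there (uproot-above u a)

uproot-keeps-above : ∀ {x F F′ y z} → Uproot x F F′ → y ≢ x → Aboveᶠ F y z → Aboveᶠ F′ y z
uproot-keeps-above (here {l} {r}) y≢ (here (topˡ _)) = ⊥-elim (y≢ refl)
uproot-keeps-above (here {l} {r}) y≢ (here (topʳ _)) = ⊥-elim (y≢ refl)
uproot-keeps-above (here {l} {r}) y≢ (here (inˡ a))  = plant-hereᶠ a
uproot-keeps-above (here {l} {r}) y≢ (here (inʳ a))  = plant-thereᶠ l (plant-hereᶠ a)
uproot-keeps-above (here {l} {r}) y≢ (there a)       = plant-thereᶠ l (plant-thereᶠ r a)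
uproot-keeps-above (there u)      y≢ (here a)        = here a
uproot-keeps-above (there u)      y≢ (there a)       = there (uproot-keeps-above u y≢ a)

-- Executions

-- The loop invariant. The superscripts of `twinʳ` and `twinˡ` tell on which side of the ancestor
-- `y` its neighbour `z` stands. Neighbours may be unrelated in the forest, hence the negative form
-- instead of a canopy.
record State (F : Forest) (T : BTree Node) : Set where
  field
    nodes≡ : nodesᶠ F ≡ nodes T
    sorted : Sorted (nodes T)
    twinʳ  : ∀ {y z} → Neighbours (nodes T) y z → Aboveᶠ F y z → ¬ Above T y z
    twinˡ  : ∀ {y z} → Neighbours (nodes T) z y → Aboveᶠ F y z → ¬ Above T y z

  sortedᶠ : Sorted (nodesᶠ F)
  sortedᶠ = subst Sorted (≡.sym nodes≡) sorted

  toᶠ : ∀ {x} → x ∈ nodes T → x ∈ nodesᶠ F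
  toᶠ = subst (_ ∈_) (≡.sym nodes≡)

  fromᶠ : ∀ {x} → x ∈ nodesᶠ F → x ∈ nodes T
  fromᶠ = subst (_ ∈_) nodes≡

-- The search for a removable root runs along suffixes of the forest; a node of `T` outside the
-- suffix belongs to an earlier tree.
Covers : List Node → List Node → Set
Covers ns ms = ∀ {y} → y ∈ ns → y ∈ ms ⊎ (∀ {z} → z ∈ ms → y <ᴺ z)

Unblocked : BTree Node → Node → Set
Unblocked T x = ∀ {y} → Neighbours (nodes T) y x → ¬ Above T x y

-- A successor `y` below `x` in `T` is not below `x` in the forest, by `twinʳ`, and does not precede
-- the suffix, as it follows `x`. So it lies in a later tree. `G` is the whole forest, of which the
-- invariant speaks.
first-root : ∀ {G T l x r F} → State G T →
  (∀ {y z} → Aboveᶠ (tree l x r ∷ F) y z → Aboveᶠ G y z) →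
  Covers (nodes T) (nodesᶠ (tree l x r ∷ F)) →
  x ∈ nodes T → Unblocked T x →
  x ∈ childless T ⊎ (∃[ y ] y ∈ nodesᶠ F × Neighbours (nodes T) x y × Above T x y)
first-root {T = T} {l} {x} {r} st emb covers x∈ unblocked with child T (State.sorted st) x∈
... | none c    = inj₁ c
... | pred nb a = ⊥-elim (unblocked nb a)
... | succ {y} nb a with covers (Neighbours.z∈ nb)
...   | inj₂ y<F = ⊥-elim (<ᴺ-asym (y<F (∈-++⁺ˡ (∈-at (nodes l)))) (Neighbours.y<z nb))
...   | inj₁ y∈ with ∈-++⁻ (nodes (node l x r)) y∈
...     | inj₂ y∈F = inj₂ (y , y∈F , nb , a)
...     | inj₁ y∈t with locate (nodes l) y∈t
...       | before y∈l = ⊥-elim (State.twinʳ st nb (emb (here (topˡ y∈l))) a)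
...       | at refl    = ⊥-elim (<ᴺ-irrefl (Neighbours.y<z nb))
...       | after y∈r  = ⊥-elim (State.twinʳ st nb (emb (here (topʳ y∈r))) a)

-- If the root of the first tree has a child in T, then it is blocked by its successor, which
-- lies in the next tree: each of the gaps between consecutive trees of the forest blocks at
-- most one of the two neighbouring roots, and there are fewer gaps than roots.
free-root : ∀ {G T l x r} F → State G T →
  (∀ {y z} → Aboveᶠ (tree l x r ∷ F) y z → Aboveᶠ G y z) →
  Sorted (nodesᶠ (tree l x r ∷ F)) →
  Covers (nodes T) (nodesᶠ (tree l x r ∷ F)) →
  (∀ {y} → y ∈ nodesᶠ (tree l x r ∷ F) → y ∈ nodes T) →
  Unblocked T x →
  ∃[ z ] z ∈ roots (tree l x r ∷ F) × z ∈ childless T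
free-root {l = l} F st emb s covers ⊆T unblocked
  with first-root st emb covers (⊆T (∈-++⁺ˡ (∈-at (nodes l)))) unblocked
free-root {x = x} F st emb s covers ⊆T unblocked
  | inj₁ c = x , here refl , c
free-root {T = T} {l} {x} {r} F@(tree l′ x′ r′ ∷ F′) st emb s covers ⊆T unblocked
  | inj₂ (y , y∈F , nb , a)
  = add-tree (free-root F′ st (emb ∘ there) sF covers′ (⊆T ∘ ∈-++⁺ʳ (nodes (node l x r))) unblocked′)
  where
  add-tree : ∃[ z ] z ∈ roots F × z ∈ childless T → ∃[ z ] z ∈ x ∷ roots F × z ∈ childless T
  add-tree (z , z∈ , c) = z , there z∈ , c
  t<F : ∀ {y z} → y ∈ nodes (node l x r) → z ∈ nodesᶠ F → y <ᴺ z
  t<F = proj₂ (proj₂ (AllPairs-++⁻ (nodes (node l x r)) s))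
  sF : Sorted (nodesᶠ F)
  sF = proj₁ (proj₂ (AllPairs-++⁻ (nodes (node l x r)) s))
  x∈t : x ∈ nodes (node l x r)
  x∈t = ∈-at (nodes l)
  x∈T : x ∈ nodes T
  x∈T = ⊆T (∈-++⁺ˡ x∈t)
  x<x′ : x <ᴺ x′
  x<x′ = t<F x∈t (∈-++⁺ˡ (∈-at (nodes l′)))
  covers′ : Covers (nodes T) (nodesᶠ F)
  covers′ z∈ with covers z∈
  ... | inj₂ z< = inj₂ (z< ∘ ∈-++⁺ʳ (nodes (node l x r)))
  ... | inj₁ z∈ with ∈-++⁻ (nodes (node l x r)) z∈
  ...   | inj₁ z∈t = inj₂ (t<F z∈t)
  ...   | inj₂ z∈F = inj₁ z∈F
  unblocked′ : Unblocked T x′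
  unblocked′ nb′ a′ with covers′ (Neighbours.y∈ nb′)
  unblocked′ nb′ a′ | inj₁ z∈F with ∈-++⁻ (nodes (node l′ x′ r′)) z∈F
  ... | inj₂ z∈F′ = <ᴺ-asym (Neighbours.y<z nb′)
    (proj₂ (proj₂ (AllPairs-++⁻ (nodes (node l′ x′ r′)) sF)) (∈-at (nodes l′)) z∈F′)
  ... | inj₁ z∈t′ with locate (nodes l′) z∈t′
  ...   | before z∈l′ = State.twinˡ st nb′ (emb (there (here (topˡ z∈l′)))) a′
  ...   | at refl     = <ᴺ-irrefl (Neighbours.y<z nb′)
  ...   | after z∈r′  = State.twinˡ st nb′ (emb (there (here (topʳ z∈r′)))) a′
  -- The predecessor of `x′` precedes `F`, whereas the successor `y` of `x` lies in `F`. The empty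
  -- gaps force that predecessor to be `x` and `y` to be `x′`; then `x` and `x′` would each be above
  -- the other in `T`.
  unblocked′ nb′ a′ | inj₂ z<F with compare (State.sorted st) x∈T (Neighbours.y∈ nb′)
  ... | inj₂ (inj₁ x<z) = Neighbours.gap nb (Neighbours.y∈ nb′) x<z (z<F y∈F)
  ... | inj₂ (inj₂ z<x) = Neighbours.gap nb′ x∈T z<x x<x′
  ... | inj₁ refl with compare (State.sorted st) (Neighbours.z∈ nb) (Neighbours.z∈ nb′)
  ...   | inj₁ refl        = above-asym (State.sorted st) a a′
  ...   | inj₂ (inj₁ y<x′) = Neighbours.gap nb′ (Neighbours.z∈ nb) (Neighbours.y<z nb) y<x′
  ...   | inj₂ (inj₂ x′<y) = Neighbours.gap nb (Neighbours.z∈ nb′) x<x′ x′<y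

exists-candidate : ∀ {t F T} → State (t ∷ F) T → ∃[ x ] x ∈ roots (t ∷ F) × x ∈ childless T
exists-candidate {tree l x r} {F} st = free-root F st id sortedᶠ (inj₁ ∘ toᶠ) fromᶠ unblocked
  where
  open State st
  unblocked : ∀ {y} → Neighbours _ y x → ¬ Above _ x y
  unblocked nb a with ∈-++⁻ (nodes (node l x r)) (toᶠ (Neighbours.y∈ nb))
  ... | inj₂ y∈F = <ᴺ-asym (Neighbours.y<z nb)
    (proj₂ (proj₂ (AllPairs-++⁻ (nodes (node l x r)) sortedᶠ)) (∈-at (nodes l)) y∈F)
  ... | inj₁ y∈t with locate (nodes l) y∈t
  ...   | before y∈l = twinˡ nb (here (topˡ y∈l)) a
  ...   | at refl    = <ᴺ-irrefl (Neighbours.y<z nb)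
  ...   | after y∈r  = twinˡ nb (here (topʳ y∈r)) a

candidate⁺ : ∀ {x} F T → x ∈ roots F → x ∈ childless T → x ∈ candidates F T
candidate⁺ F T x∈F x∈T = ∈-filter⁺ _ x∈F (∈-map⁺ proj₁ x∈T)

-- `candidates` compares indices only; these determine the nodes of the common inorder list, so the
-- childless node found is the root itself.
candidate⁻ : ∀ {x F T} → State F T → x ∈ candidates F T → x ∈ roots F × x ∈ childless T
candidate⁻ {F = F} {T} st x∈ with ∈-filter⁻ _ {xs = roots F} x∈
... | x∈F , i∈ with ∈-map⁻ proj₁ i∈
...   | y , y∈ , eq
    with index-injective (State.sorted st) (State.fromᶠ st (roots-⊆ F x∈F)) (childless-⊆ T y∈) eq
...     | refl = x∈F , y∈

module _ {x F T F′ T′} (st : State F T) (u : Uproot x F F′) (p : Prune x T T′) where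

  open State st

  private
    keep : ∀ {y z} → Neighbours (nodes T′) y z → ¬ (y <ᴺ x × x <ᴺ z) → Neighbours (nodes T) y z
    keep nb x∉ = record
      { y∈ = removal-⊆ ρ y∈ ; z∈ = removal-⊆ ρ z∈ ; y<z = y<z
      ; gap = λ {w} w∈ y<w w<z →
          gap (removal-keeps ρ (λ { refl → x∉ (y<w , w<z) }) w∈) y<w w<z }
      where
      open Neighbours nb
      ρ = prune-removal p

  -- The only new neighbours are the two nodes around `x`. If one were above the other in the
  -- forest, it would by convexity be above `x` too.
  step : (∀ {z} → ¬ Aboveᶠ F z x) → State F′ T′
  step maximal = record
    { nodes≡ = removal-functional sortedᶠ (uproot-removal u)
        (subst (λ ns → Removal x ns (nodes T′)) (≡.sym nodes≡) (prune-removal p))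
    ; sorted = removal-AllPairs (prune-removal p) sorted
    ; twinʳ  = λ nb a b → twinʳ
        (keep nb λ (y<x , x<z) → maximal (aboveᶠ-between sortedᶠ (uproot-above u a) x∈ (up y<x x<z)))
        (uproot-above u a) (prune-above p b)
    ; twinˡ  = λ nb a b → twinˡ
        (keep nb λ (z<x , x<y) → maximal (aboveᶠ-between sortedᶠ (uproot-above u a) x∈ (down z<x x<y)))
        (uproot-above u a) (prune-above p b)
    }
    where x∈ = removal-∈ (uproot-removal u)

-- Common linear extensions

-- `F` asks for ancestors first and `T` for descendants first; `y` may stand before `z` if neither
-- asks for the opposite.
Precedes : Forest → BTree Node → Rel Node 0ℓ
Precedes F T y z = ¬ Aboveᶠ F z y × ¬ Above T y z

record LinearExtension (F : Forest) (T : BTree Node) (s : List Node) : Set where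
  constructor _,_
  field
    perm  : s ↭ nodes T
    order : AllPairs (Precedes F T) s

open LinearExtension

label : Node → Letter
label = proj₂

module _ {x F T F′ T′} (st : State F T) (u : Uproot x F F′) (p : Prune x T T′) where

  open State st

  -- `x` may come first because it has no ancestor in `F` and no descendant in `T`. The other nodes
  -- differ from `x`, so the deletion does not alter the relations among them.
  extend : ∀ {s} → (∀ {z} → ¬ Aboveᶠ F z x) → LinearExtension F′ T′ s → LinearExtension F T (x ∷ s)
  extend {s} maximal (s↭ , ps) =
    ↭-trans (prep x s↭) (↭-sym (removal-↭ ρ)) ,
    All.tabulate (λ _ → maximal , pruned-minimal sorted p) ∷ lift s (λ z∈ → z∈) ps
    where
    ρ = prune-removal p
    ≢x : ∀ {z} → z ∈ s → z ≢ x
    ≢x z∈ refl = removed sorted ρ (∈-resp-↭ s↭ z∈)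
      where
      removed : ∀ {xs ys} → Sorted xs → Removal x xs ys → ¬ x ∈ ys
      removed (q ∷ _)  here      x∈          = <ᴺ-irrefl (All.lookup q x∈)
      removed (q ∷ _)  (there ρ) (here refl) = <ᴺ-irrefl (All.lookup q (removal-∈ ρ))
      removed (_ ∷ qs) (there ρ) (there x∈)  = removed qs ρ x∈
    lift : ∀ s′ → (∀ {z} → z ∈ s′ → z ∈ s) → AllPairs (Precedes F′ T′) s′ → AllPairs (Precedes F T) s′
    lift []       _  []       = []
    lift (y ∷ s′) s⊆ (q ∷ qs) =
      All.tabulate (λ z∈ →
        (λ a → proj₁ (All.lookup q z∈) (uproot-keeps-above u (≢x (s⊆ (there z∈))) a)) ,
        (λ a → proj₂ (All.lookup q z∈) (prune-keeps-above p (≢x (s⊆ (there z∈))) a))) ∷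
      lift s′ (s⊆ ∘ there) qs

  restrict : ∀ xs {ys} → LinearExtension F T (xs ++ x ∷ ys) → LinearExtension F′ T′ (xs ++ ys)
  restrict xs (s↭ , ps) =
    drop-mid xs [] (↭-trans s↭ (removal-↭ (prune-removal p))) ,
    removal-AllPairs (removal-mid xs)
      (AllPairs.map (λ (¬a , ¬b) → ¬a ∘ uproot-above u , ¬b ∘ prune-above p) ps)

-- The greedy exchange argument

-- What the two algorithms share: `_≺_` is the inorder order or its converse, `chosen` yields a
-- minimal candidate for it, and `_≼_` is the permutohedron order on words or its converse.
record Direction (choose : Choice) : Set₁ where
  infix 4 _≺_ _≼_
  field
    _≺_           : Rel Node 0ℓ
    total         : ∀ {x y xs} → Sorted xs → x ∈ xs → y ∈ xs → x ≡ y ⊎ x ≺ y ⊎ y ≺ x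
    between       : ∀ {x y z} → x ≺ y → y ≺ z → Between x y z
    chosen        : ∀ x xs → ∃[ y ] choose (x ∷ xs) ≡ just y
                    × y ∈ x ∷ xs × (∀ {z} → z ∈ x ∷ xs → ¬ z ≺ y)
    _≼_           : Rel Word 0ℓ
    ≼-refl        : ∀ {u} → u ≼ u
    ≼-trans       : ∀ {u v w} → u ≼ v → v ≼ w → u ≼ w
    ≼-cons        : ∀ a {u v} → u ≼ v → a ∷ u ≼ a ∷ v
    ≼-swap        : ∀ {x y} u → x ≺ y → label x ∷ label y ∷ u ≼ label y ∷ label x ∷ u

between-sym : ∀ {x y z} → Between x y z → Between z y x
between-sym (up x<y y<z)   = down x<y y<z
between-sym (down z<y y<x) = up z<y y<x

module Greedy {choose : Choice} (direction : Direction choose) where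

  open Direction direction

  -- A node k ≺ i preceding i would be blocked by some j preceding k; for the first such k,
  -- i lies between k and j, so that j (resp. k) would also be comparable with i.
  pull-out : ∀ {i F T} → State F T → i ∈ roots F → (∀ {k} → k ∈ roots F → k ∈ childless T → ¬ k ≺ i) →
    ∀ xs ys → LinearExtension F T (xs ++ ys) → All (i ≺_) xs → i ∈ ys →
    ∃₂ λ us vs → xs ++ ys ≡ us ++ i ∷ vs × All (i ≺_) us
  pull-out st i∈F least xs (k ∷ ys) ext i≺xs (here refl) = xs , ys , refl , i≺xs
  pull-out {i} {F} {T} st i∈F least xs (k ∷ ys) ext i≺xs (there i∈ys)
    with total (State.sorted st) (State.fromᶠ st (roots-⊆ F i∈F)) (∈-resp-↭ (perm ext) (∈-at xs))
  ... | inj₁ refl = xs , ys , refl , i≺xs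
  ... | inj₂ (inj₁ i≺k)
    rewrite ≡.sym (++-assoc xs (k ∷ []) ys) =
    pull-out st i∈F least (xs ∷ʳ k) ys ext (All.∷ʳ⁺ i≺xs i≺k) i∈ys
  ... | inj₂ (inj₂ k≺i) = ⊥-elim blocked
    where
    open State st
    k∈ : k ∈ nodes T
    k∈ = ∈-resp-↭ (perm ext) (∈-at xs)
    i∈ : i ∈ nodesᶠ F
    i∈ = roots-⊆ F i∈F
    orders = AllPairs-++⁻ xs (order ext)
    after-k : ∀ {y} → y ∈ ys → Precedes F T k y
    after-k with orders
    ... | _ , q ∷ _ , _ = All.lookup q
    blocked-above : ∀ {j} → Aboveᶠ F j k → ⊥
    blocked-above {j} a with locate xs (∈-resp-↭ (↭-sym (perm ext)) (fromᶠ (aboveᶠ-∈ˡ a)))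
    ... | before j∈xs = rootᶠ-maximal sortedᶠ i∈F
      (aboveᶠ-between sortedᶠ a i∈ (between-sym (between k≺i (All.lookup i≺xs j∈xs))))
    ... | at refl     = aboveᶠ-irrefl sortedᶠ a
    ... | after j∈ys  = proj₁ (after-k j∈ys) a
    blocked-below : ∀ {j} → Above T k j → ⊥
    blocked-below {j} a with locate xs (∈-resp-↭ (↭-sym (perm ext)) (above-∈ʳ a))
    ... | before j∈xs = proj₂ (after-k i∈ys)
      (above-between sorted a (fromᶠ i∈) (between k≺i (All.lookup i≺xs j∈xs)))
    ... | at refl     = above-asym sorted a a
    ... | after j∈ys  = proj₂ (after-k j∈ys) a
    blocked : ⊥
    blocked with root-or-below F (toᶠ k∈) | child T sorted k∈
    ... | inj₂ (_ , a) | _        = blocked-above a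
    -- With no obstruction left, `k` would itself be a candidate, against the minimality of `i`.
    ... | inj₁ _       | pred _ b = blocked-below b
    ... | inj₁ _       | succ _ b = blocked-below b
    ... | inj₁ k∈F     | none k∈T = least k∈F k∈T k≺i

  -- Every node passed follows `i` in `_≺_`, so each single exchange is a `≼-swap`.
  move-front : ∀ {i} xs ys → All (i ≺_) xs →
    label i ∷ map label (xs ++ ys) ≼ map label (xs ++ i ∷ ys)
  move-front []       ys []       = ≼-refl
  move-front (x ∷ xs) ys (p ∷ ps) = ≼-trans (≼-swap _ p) (≼-cons _ (move-front xs ys ps))

  Result : (k : ℕ) (u : Word) (F : Forest) (T : BTree Node) → Set
  Result k u F T = ∃[ w ] loop choose k u F T ≡ just (u ++ map label w)
    × LinearExtension F T w × (∀ {s} → LinearExtension F T s → map label w ≼ map label s)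

  -- Induction on the number of remaining nodes, which is also the number of iterations allowed.
  -- That equality excludes running out of iterations, and `exists-candidate` excludes a failing
  -- choice.
  greedy : ∀ k u F T → State F T → length (nodes T) ≡ k → Result k u F T
  greedy k u [] T st len = [] , cong just (≡.sym (++-identityʳ u)) ,
    (↭-reflexive nodes≡ , []) ,
    λ (s↭ , _) → subst (λ s → [] ≼ map label s)
      (≡.sym (↭-empty-inv (↭-trans s↭ (↭-reflexive (≡.sym nodes≡))))) ≼-refl
    where open State st
  greedy k u (tree l x r ∷ F) (leaf _) st len = ⊥-elim (not-empty (nodes l) (State.nodes≡ st))
    where
    not-empty : ∀ xs {x : Node} {ys zs} → (xs ++ x ∷ ys) ++ zs ≢ []
    not-empty [] ()
    not-empty (_ ∷ _) ()
  greedy zero u (_ ∷ _) (node l x r) st len with nodes-∷ l x r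
  ... | _ , _ , eq with () ← ≡.trans (≡.sym len) (cong length eq)
  greedy (suc k) u F@(_ ∷ _) T@(node _ _ _) st len
    with candidates F T in eq | exists-candidate st
  ... | [] | x , x∈F , x∈T with () ← subst (x ∈_) eq (candidate⁺ F T x∈F x∈T)
  ... | c ∷ cs | _ with chosen c cs
  ...   | i , eq′ , i∈ , least
    with candidate⁻ st (subst (i ∈_) (≡.sym eq) i∈)
  ...   | i∈F , i∈T rewrite eq′ = continue
    where
    open State st
    F′ : Forest
    F′ = suppressRoot (proj₁ i) F
    T′ : BTree Node
    T′ = suppressChildless (proj₁ i) T
    u′ : Uproot i F F′
    u′ = uproot F sortedᶠ i∈F
    p′ : Prune i T T′
    p′ = prune T sorted i∈T
    maximal : ∀ {z} → ¬ Aboveᶠ F z i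
    maximal = rootᶠ-maximal sortedᶠ i∈F
    least′ : ∀ {k} → k ∈ roots F → k ∈ childless T → ¬ k ≺ i
    least′ k∈F k∈T = least (subst (_ ∈_) eq (candidate⁺ F T k∈F k∈T))
    continue : ∃[ w ] loop choose k (u ∷ʳ label i) F′ T′ ≡ just (u ++ map label w)
      × LinearExtension F T w × (∀ {s} → LinearExtension F T s → map label w ≼ map label s)
    continue with greedy k (u ∷ʳ label i) F′ T′ (step st u′ p′ maximal)
      (suc-injective (≡.trans (≡.sym (removal-length (prune-removal p′))) len))
    ... | w , w≡ , ext , w≼ = i ∷ w ,
      ≡.trans w≡ (cong just (++-assoc u (label i ∷ []) (map label w))) ,
      extend st u′ p′ maximal ext ,
      λ ext′ → optimal ext′
      where
      optimal : ∀ {s} → LinearExtension F T s → map label (i ∷ w) ≼ map label s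
      optimal {s} ext′
        -- In any competitor `i` can be brought to the front; the rest is a linear extension of the
        -- smaller state and is bounded by induction.
        with pull-out st i∈F least′ [] s ext′ [] (∈-resp-↭ (↭-sym (perm ext′)) (fromᶠ (roots-⊆ F i∈F)))
      ... | xs , ys , refl , i≺xs =
        ≼-trans (≼-cons _ (w≼ (restrict st u′ p′ xs ext′))) (move-front xs ys i≺xs)

-- Insertion into binary search trees

filter-map : {P : Pred B 0ℓ} (P? : Unary.Decidable P) (f : A → B) (xs : List A) →
  filter P? (map f xs) ≡ map f (filter (P? ∘ f) xs)
filter-map P? f []       = refl
filter-map P? f (x ∷ xs) with does (P? (f x))
... | true  = cong (f x ∷_) (filter-map P? f xs)
... | false = filter-map P? f xs

node-injective : ∀ {l l′ r r′ : BTree A} {x x′} → node l x r ≡ node l′ x′ r′ → l ≡ l′ × x ≡ x′ × r ≡ r′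
node-injective refl = refl , refl , refl

-- The two filtered lists may be interleaved arbitrarily, so a pair with one entry from each needs
-- `T` in both directions.
AllPairs-unfilter : {P : Pred A 0ℓ} (P? : Unary.Decidable P) {R S T : Rel A 0ℓ} (xs : List A) →
  (∀ {x y} → x ∈ xs → y ∈ xs → P x → P y → R x y → T x y) →
  (∀ {x y} → x ∈ xs → y ∈ xs → ¬ P x → ¬ P y → S x y → T x y) →
  (∀ {x y} → x ∈ xs → y ∈ xs → P x → ¬ P y → T x y × T y x) →
  AllPairs R (filter P? xs) → AllPairs S (filter (¬? ∘ P?) xs) → AllPairs T xs
AllPairs-unfilter P? [] _ _ _ _ _ = []
AllPairs-unfilter P? {R} {S} {T} (x ∷ xs) both neither cross rs ss with P? x | rs | ss
... | yes px | r ∷ rs′ | ss′ = All.tabulate first ∷ AllPairs-unfilter P? xs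
    (λ y∈ z∈ → both (there y∈) (there z∈)) (λ y∈ z∈ → neither (there y∈) (there z∈))
    (λ y∈ z∈ → cross (there y∈) (there z∈)) rs′ ss′
  where
  first : ∀ {y} → y ∈ xs → T x y
  first {y} y∈ with P? y
  ... | yes py = both (here refl) (there y∈) px py (All.lookup r (∈-filter⁺ P? y∈ py))
  ... | no ¬py = proj₁ (cross (here refl) (there y∈) px ¬py)
... | no ¬px | rs′ | s ∷ ss′ = All.tabulate first ∷ AllPairs-unfilter P? xs
    (λ y∈ z∈ → both (there y∈) (there z∈)) (λ y∈ z∈ → neither (there y∈) (there z∈))
    (λ y∈ z∈ → cross (there y∈) (there z∈)) rs′ ss′
  where
  first : ∀ {y} → y ∈ xs → T x y
  first {y} y∈ with P? y
  ... | yes py = proj₂ (cross (there y∈) (here refl) py ¬px)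
  ... | no ¬py = neither (here refl) (there y∈) ¬px ¬py (All.lookup s (∈-filter⁺ (¬? ∘ P?) y∈ ¬py))

module Insertion {_◁_ : Rel Letter 0ℓ} (_◁?_ : Decidable _◁_) where

  insert : Letter → LTree → LTree
  insert a (leaf _)     = node ∙ a ∙
  insert a (node l b r) =
    if does (a ◁? b) then node (insert a l) b r else node l b (insert a r)

  insertAll : LTree → Word → LTree
  insertAll = foldl (flip insert)

  insert-↭ : ∀ a t → nodes (insert a t) ↭ a ∷ nodes t
  insert-↭ a (leaf _) = ↭-refl
  insert-↭ a (node l b r) with does (a ◁? b)
  ... | true  = ++⁺ʳ (b ∷ nodes r) (insert-↭ a l)
  ... | false = ↭-trans (++⁺ˡ (nodes l) (↭-trans (prep b (insert-↭ a r)) (↭-swap b a ↭-refl)))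
                        (shift a (nodes l) (b ∷ nodes r))

  insertAll-↭ : ∀ t v → nodes (insertAll t v) ↭ v ++ nodes t
  insertAll-↭ t []      = ↭-refl
  insertAll-↭ t (a ∷ v) = ↭-trans (insertAll-↭ (insert a t) v)
    (↭-trans (++⁺ˡ v (insert-↭ a t)) (shift a v (nodes t)))

  -- The side a letter takes depends on the root alone, so the two subtrees grow from independent
  -- subwords.
  insertAll-node : ∀ l b r v → insertAll (node l b r) v ≡
    node (insertAll l (filter (_◁? b) v)) b (insertAll r (filter (¬? ∘ (_◁? b)) v))
  insertAll-node l b r []      = refl
  insertAll-node l b r (a ∷ v) with does (a ◁? b)
  ... | true  = insertAll-node (insert a l) b r v
  ... | false = insertAll-node l b (insert a r) v

  -- The letters a and d take different branches, hence their insertions commute.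
  data Separates (a d : Letter) : LTree → Set where
    split : ∀ {l b r} → a ◁ b → ¬ d ◁ b → Separates a d (node l b r)
    inˡ   : ∀ {l b r} → a ◁ b → d ◁ b → Separates a d l → Separates a d (node l b r)
    inʳ   : ∀ {l b r} → ¬ a ◁ b → ¬ d ◁ b → Separates a d r → Separates a d (node l b r)

  insert-comm : ∀ {a d t} → Separates a d t → insert d (insert a t) ≡ insert a (insert d t)
  insert-comm {a} {d} (split {b = b} a◁b d⋪b)
    rewrite dec-true (a ◁? b) a◁b | dec-false (d ◁? b) d⋪b | dec-true (a ◁? b) a◁b = refl
  insert-comm {a} {d} (inˡ {b = b} a◁b d◁b s)
    rewrite dec-true (a ◁? b) a◁b | dec-true (d ◁? b) d◁b | dec-true (a ◁? b) a◁b =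
    cong (λ l → node l b _) (insert-comm s)
  insert-comm {a} {d} (inʳ {b = b} a⋪b d⋪b s)
    rewrite dec-false (a ◁? b) a⋪b | dec-false (d ◁? b) d⋪b | dec-false (a ◁? b) a⋪b =
    cong (node _ b) (insert-comm s)

  insert-separates : ∀ {a d t} e → Separates a d t → Separates a d (insert e t)
  insert-separates e (split {b = b} p q) with does (e ◁? b)
  ... | true  = split p q
  ... | false = split p q
  insert-separates e (inˡ {b = b} p q s) with does (e ◁? b)
  ... | true  = inˡ p q (insert-separates e s)
  ... | false = inˡ p q s
  insert-separates e (inʳ {b = b} p q s) with does (e ◁? b)
  ... | true  = inʳ p q s
  ... | false = inʳ p q (insert-separates e s)

  insertAll-separates : ∀ {a d t} u → Separates a d t → Separates a d (insertAll t u)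
  insertAll-separates []      s = s
  insertAll-separates (e ∷ u) s = insertAll-separates u (insert-separates e s)

  insertʳ-separates : ∀ {a d t} u → Separates a d t → Separates a d (foldr insert t u)
  insertʳ-separates []      s = s
  insertʳ-separates (e ∷ u) s = insert-separates e (insertʳ-separates u s)

  -- Where `c` turns left so does `a`, and where `c` turns right so does `d`. Hence `a` and `d`
  -- either part on the way or both follow `c` to its new node and part there.
  separator : ∀ {a c d} → (∀ {b} → c ◁ b → a ◁ b) → (∀ {b} → ¬ c ◁ b → ¬ d ◁ b) →
    a ◁ c → ¬ d ◁ c → ∀ t → Separates a d (insert c t)
  separator left right a◁c d⋪c (leaf _) = split a◁c d⋪c
  separator {a} {c} {d} left right a◁c d⋪c (node l b r) with c ◁? b
  ... | yes c◁b with d ◁? b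
  ...   | yes d◁b = inˡ (left c◁b) d◁b (separator left right a◁c d⋪c l)
  ...   | no d⋪b  = split (left c◁b) d⋪b
  separator {a} {c} {d} left right a◁c d⋪c (node l b r) | no c⋪b with a ◁? b
  ...   | yes a◁b = split a◁b (right c⋪b)
  ...   | no a⋪b  = inʳ a⋪b (right c⋪b) (separator left right a◁c d⋪c r)

  data Search : BTree Node → Set where
    leaf : Search ∙
    node : ∀ {l x r} → (∀ {y} → y ∈ nodes l → label y ◁ label x) →
           (∀ {y} → y ∈ nodes r → ¬ label y ◁ label x) →
           Search l → Search r → Search (node l x r)

  Unbelow : BTree Node → Rel Node 0ℓ
  Unbelow t y z = ¬ Above t z y

  left? : ∀ b → Unary.Decidable (λ (y : Node) → label y ◁ b)
  left? b y = label y ◁? b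

  insertAll-split : ∀ b s → insertAll ∙ (b ∷ map label s) ≡
    node (insertAll ∙ (map label (filter (left? b) s))) b
         (insertAll ∙ (map label (filter (¬? ∘ left? b) s)))
  insertAll-split b s = ≡.trans (insertAll-node ∙ b ∙ (map label s))
    (cong₂ (λ u v → node (insertAll ∙ u) b (insertAll ∙ v))
      (filter-map _ label s) (filter-map _ label s))

  module _ {b : Letter} {xs ys : List Node}
           (left : ∀ {y} → y ∈ xs → label y ◁ b)
           (right : ∀ {y} → y ∈ ys → ¬ label y ◁ b)
           {s : List Node} (s↭ : s ↭ xs ++ ys) where

    smaller-↭ : filter (left? b) s ↭ xs
    smaller-↭ = ↭-trans (filter-↭ _ s↭) (↭-reflexive
      (≡.trans (filter-++ _ xs ys)
      (≡.trans (cong₂ _++_ (filter-all (left? b) (All.tabulate left))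
                           (filter-none (left? b) (All.tabulate right)))
               (++-identityʳ xs))))

    larger-↭ : filter (¬? ∘ left? b) s ↭ ys
    larger-↭ = ↭-trans (filter-↭ _ s↭) (↭-reflexive
      (≡.trans (filter-++ _ xs ys)
               (cong₂ _++_ (filter-none (¬? ∘ left? b) (All.tabulate λ y∈ ¬left → ¬left (left y∈)))
                           (filter-all (¬? ∘ left? b) (All.tabulate right)))))

  -- All other nodes are below the root, so if `y` were not the root, the root would occur later in
  -- the list and be above `y`.
  head-root : ∀ {l r : BTree Node} {x s y} → y ∷ s ↭ nodes (node l x r) →
    (x ∈ s → ¬ Above (node l x r) x y) → y ≡ x
  head-root {l} s↭ h with ∈-resp-↭ (↭-sym s↭) (∈-at (nodes l)) | locate (nodes l) (∈-resp-↭ s↭ (here refl))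
  ... | here refl | _         = refl
  ... | there _   | at y≡x    = y≡x
  ... | there x∈  | before y∈ = ⊥-elim (h x∈ (topˡ y∈))
  ... | there x∈  | after y∈  = ⊥-elim (h x∈ (topʳ y∈))

  nonempty-perm : ∀ (l : BTree Node) x r → ¬ ([] ↭ nodes (node l x r))
  nonempty-perm l x r p = nodes-≢[] l x r (↭-empty-inv (↭-sym p))

  drop-root : ∀ (l r : BTree Node) {x s} → x ∷ s ↭ nodes (node l x r) → s ↭ nodes l ++ nodes r
  drop-root l r {x} s↭ = drop-∷ (↭-trans s↭ (shift x (nodes l) (nodes r)))

  -- If ancestors come first, the list starts with the root, and comparison with its label splits
  -- the rest into such lists for the two subtrees.
  insertAll-linear : ∀ {t s} → Search t → s ↭ nodes t → AllPairs (Unbelow t) s →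
    insertAll ∙ (map label s) ≡ mapₙ label t
  insertAll-linear leaf s↭ _ with refl ← ↭-empty-inv s↭ = refl
  insertAll-linear {node l x r} {[]} _ s↭ _ = ⊥-elim (nonempty-perm l x r s↭)
  insertAll-linear {node l x r} {y ∷ s} (node left right searchˡ searchʳ) s↭ (p ∷ ps)
    with head-root s↭ (All.lookup p)
  ... | refl = ≡.trans (insertAll-split (label x) s) (cong₂ (λ l r → node l (label x) r)
      (insertAll-linear searchˡ (smaller-↭ left right s↭′) (AllPairs.map (_∘ inˡ) (filter⁺ _ ps)))
      (insertAll-linear searchʳ (larger-↭ left right s↭′) (AllPairs.map (_∘ inʳ) (filter⁺ _ ps))))
    where s↭′ = drop-root l r s↭

  -- The trees are compared by labels only, so nodes with equal labels must be told apart: `_≪_`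
  -- puts an ancestor before a descendant of equal label, and `s` lists equal labels compatibly with
  -- it.
  insertAll-linear⁻ : ∀ {_≪_ : Rel Node 0ℓ} {t s} → Search t → Sorted (nodes t) →
    (∀ {y z} → Above t y z → label y ≡ label z → y ≪ z) →
    s ↭ nodes t → AllPairs (λ y z → label y ≡ label z → ¬ z ≪ y) s →
    insertAll ∙ (map label s) ≡ mapₙ label t → AllPairs (Unbelow t) s
  insertAll-linear⁻ leaf _ _ s↭ _ _ with refl ← ↭-empty-inv s↭ = []
  insertAll-linear⁻ {s = []} (node _ _ _ _) _ _ s↭ _ _ = []
  insertAll-linear⁻ {_≪_} {node l x r} {y ∷ s} (node left right searchˡ searchʳ) sorted ties s↭ (p ∷ ps) eq
    -- `y` carries the root label. If `x` came later and were above `y`, `ties` would give `x ≪ y`,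
    -- against the order of `s`.
    with head-root s↭ (λ x∈ a → All.lookup p x∈ y≈x (ties a (≡.sym y≈x)))
    where
    y≈x : label y ≡ label x
    y≈x = proj₁ (proj₂ (node-injective (≡.trans (≡.sym (insertAll-node ∙ (label y) ∙ (map label s))) eq)))
  ... | refl = All.tabulate (λ _ → root-maximal sorted) ∷
    AllPairs-unfilter _ s
      (λ y∈ z∈ y◁x z◁x ¬a a → case below z∈ a of λ where
        (inj₁ (_ , _ , a))   → ¬a a
        (inj₂ (z⋪x , _ , _)) → z⋪x z◁x)
      (λ y∈ z∈ y⋪x z⋪x ¬a a → case below z∈ a of λ where
        (inj₁ (z◁x , _ , _)) → z⋪x z◁x
        (inj₂ (_ , _ , a))   → ¬a a)
      -- Nodes on different sides of the root are unrelated, whichever comes first.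
      (λ y∈ z∈ y◁x z⋪x →
        (λ a → case below z∈ a of λ where
          (inj₁ (z◁x , _ , _)) → z⋪x z◁x
          (inj₂ (_ , y⋪x , _)) → y⋪x y◁x) ,
        (λ a → case below y∈ a of λ where
          (inj₁ (_ , z◁x , _)) → z⋪x z◁x
          (inj₂ (y⋪x , _ , _)) → y⋪x y◁x))
      (insertAll-linear⁻ searchˡ sortedˡ (ties ∘ inˡ) (smaller-↭ left right s↭′) (filter⁺ _ ps) (proj₁ eqs))
      (insertAll-linear⁻ searchʳ sortedʳ (ties ∘ inʳ) (larger-↭ left right s↭′) (filter⁺ _ ps)
        (proj₂ (proj₂ eqs)))
    where
    open Around (nodes l) sorted
    s↭′ = drop-root l r s↭
    eqs = node-injective (≡.trans (≡.sym (insertAll-split (label x) s)) eq)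
    x∉s : ¬ x ∈ s
    x∉s x∈ with ∈-++⁻ (nodes l) (∈-resp-↭ s↭′ x∈)
    ... | inj₁ x∈l = <ᴺ-irrefl (<mid x∈l)
    ... | inj₂ x∈r = <ᴺ-irrefl (mid< x∈r)
    below : ∀ {u v} → u ∈ s → Above (node l x r) u v →
      (label u ◁ label x × label v ◁ label x × Above l u v) ⊎
      (¬ label u ◁ label x × ¬ label v ◁ label x × Above r u v)
    below u∈ (topˡ _) = ⊥-elim (x∉s u∈)
    below u∈ (topʳ _) = ⊥-elim (x∉s u∈)
    below u∈ (inˡ a)  = inj₁ (left (above-∈ˡ a) , left (above-∈ʳ a) , a)
    below u∈ (inʳ a)  = inj₂ (right (above-∈ˡ a) , right (above-∈ʳ a) , a)

module L = Insertion _<?_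
module R = Insertion _≤?_

insertᴸ≡ : ∀ a t → insertᴸ a t ≡ L.insert a t
insertᴸ≡ a (leaf _) = refl
insertᴸ≡ a (node l b r) rewrite insertᴸ≡ a l | insertᴸ≡ a r = refl

insertᴿ≡ : ∀ a t → insertᴿ a t ≡ R.insert a t
insertᴿ≡ a (leaf _) = refl
insertᴿ≡ a (node l b r) rewrite insertᴿ≡ a l | insertᴿ≡ a r = refl

treeᴸ : ∀ u → proj₁ (P u) ≡ L.insertAll ∙ u
treeᴸ = foldl-cong (λ t a → insertᴸ≡ a t) ∙

-- Reversing the word turns insertion from the right into insertion from the left, so `insertAll`
-- handles both trees.
treeᴿ : ∀ u → proj₂ (P u) ≡ R.insertAll ∙ (reverse u)
treeᴿ u = ≡.trans (≡.sym (reverse-foldl (flip insertᴿ) ∙ u))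
  (foldl-cong (λ t a → insertᴿ≡ a t) ∙ (reverse u))

-- Invariance of P under the Baxter congruence

module _ {a c d} (a<c : a < c) (c≤d : c ≤ d) where

  separatorᴸ : ∀ t → L.Separates a d (L.insert c t)
  separatorᴸ = L.separator (<-trans a<c) (λ c≮b d<b → c≮b (≤-<-trans c≤d d<b)) a<c (λ d<c → <⇒≱ d<c c≤d)

  L-commute : ∀ u w t → L.insertAll t (c ∷ u ++ a ∷ d ∷ w) ≡ L.insertAll t (c ∷ u ++ d ∷ a ∷ w)
  L-commute u w t
    rewrite foldl-++ (flip L.insert) (L.insert c t) u (a ∷ d ∷ w)
          | foldl-++ (flip L.insert) (L.insert c t) u (d ∷ a ∷ w) =
    cong (λ t → L.insertAll t w) (L.insert-comm (L.insertAll-separates u (separatorᴸ t)))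

module _ {a b d} (a≤b : a ≤ b) (b<d : b < d) where

  separatorᴿ : ∀ t → R.Separates a d (R.insert b t)
  separatorᴿ = R.separator (≤-trans a≤b) (λ b≰e d≤e → b≰e (≤-trans (<⇒≤ b<d) d≤e)) a≤b (<⇒≱ b<d)

  R-commute : ∀ u v t → foldr R.insert t (u ++ a ∷ d ∷ v ++ b ∷ []) ≡
    foldr R.insert t (u ++ d ∷ a ∷ v ++ b ∷ [])
  R-commute u v t
    rewrite foldr-++ R.insert t u (a ∷ d ∷ v ++ b ∷ [])
          | foldr-++ R.insert t u (d ∷ a ∷ v ++ b ∷ [])
          | foldr-++ R.insert t v (b ∷ []) =
    cong (λ t → foldr R.insert t u) (≡.sym (R.insert-comm (R.insertʳ-separates v (separatorᴿ t))))

-- Each relation exchanges `a` and `d`. The outer letter before them enters the left tree earlier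
-- and separates them there; in `≡ᴮ-R` the outer letter after them does so. The start tree is
-- arbitrary for the sake of `++-cong`.
≡ᴮ-L : ∀ {u v} → u ≡ᴮ v → ∀ t → L.insertAll t u ≡ L.insertAll t v
≡ᴮ-L refl t = refl
≡ᴮ-L (sym e) t = ≡.sym (≡ᴮ-L e t)
≡ᴮ-L (trans e f) t = ≡.trans (≡ᴮ-L e t) (≡ᴮ-L f t)
≡ᴮ-L (++-cong {u} {u′} {v} {v′} e f) t
  rewrite foldl-++ (flip L.insert) t u v | foldl-++ (flip L.insert) t u′ v′ | ≡ᴮ-L e t =
  ≡ᴮ-L f (L.insertAll t u′)
≡ᴮ-L (cuadvb u v a≤b b<c c≤d) t = L-commute (≤-<-trans a≤b b<c) c≤d u _ t
≡ᴮ-L (budavc u v a<b b≤c c<d) t = ≡.sym (L-commute a<b (<⇒≤ (≤-<-trans b≤c c<d)) u _ t)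

≡ᴮ-R : ∀ {u v} → u ≡ᴮ v → ∀ t → foldr R.insert t u ≡ foldr R.insert t v
≡ᴮ-R refl t = refl
≡ᴮ-R (sym e) t = ≡.sym (≡ᴮ-R e t)
≡ᴮ-R (trans e f) t = ≡.trans (≡ᴮ-R e t) (≡ᴮ-R f t)
≡ᴮ-R (++-cong {u} {u′} {v} {v′} e f) t
  rewrite foldr-++ R.insert t u v | foldr-++ R.insert t u′ v′ | ≡ᴮ-R f t =
  ≡ᴮ-R e (foldr R.insert t v′)
≡ᴮ-R (cuadvb u v {c = c} a≤b b<c c≤d) t = R-commute a≤b (<-≤-trans b<c c≤d) (c ∷ u) v t
≡ᴮ-R (budavc u v {b = b} a<b b≤c c<d) t = ≡.sym (R-commute (≤-trans (<⇒≤ a<b) b≤c) c<d (b ∷ u) v t)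

P-≡ᴮ : ∀ {u v} → u ≡ᴮ v → P u ≡ P v
P-≡ᴮ {u} {v} e = cong₂ _,_
  (≡.trans (treeᴸ u) (≡.trans (≡ᴮ-L e ∙) (≡.sym (treeᴸ v))))
  (≡.trans (treeᴿ u) (≡.trans
    (≡.trans (reverse-foldl (flip R.insert) ∙ u)
      (≡.trans (≡ᴮ-R e ∙) (≡.sym (reverse-foldl (flip R.insert) ∙ v))))
    (≡.sym (treeᴿ v))))

-- Numbered trees

inorder≡nodes : (t : LTree) → inorder t ≡ nodes t
inorder≡nodes t = ≡.trans (go t []) (++-identityʳ (nodes t))
  where
  go : ∀ t ks → Infix.toDiffList t ks ≡ nodes t ++ ks
  go (leaf _) ks = refl
  go (node l x r) ks = ≡.trans (go l _)
    (≡.trans (cong (λ ks → nodes l ++ x ∷ ks) (go r ks)) (≡.sym (++-assoc (nodes l) (x ∷ nodes r) ks)))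

#nodes≡length : (t : BTree A) → #nodes t ≡ length (nodes t)
#nodes≡length (leaf _)     = refl
#nodes≡length (node l x r) = ≡.trans (cong₂ _+_ (#nodes≡length l) (cong suc (#nodes≡length r)))
  (≡.sym (length-++ (nodes l)))

enumerate : ℕ → Word → List Node
enumerate k []      = []
enumerate k (a ∷ w) = (k , a) ∷ enumerate (suc k) w

enumerate-++ : ∀ k u v → enumerate k (u ++ v) ≡ enumerate k u ++ enumerate (k + length u) v
enumerate-++ k []      v rewrite +-identityʳ k = refl
enumerate-++ k (a ∷ u) v rewrite +-suc k (length u) = cong ((k , a) ∷_) (enumerate-++ (suc k) u v)

enumerate-labels : ∀ k w → map label (enumerate k w) ≡ w
enumerate-labels k []      = refl
enumerate-labels k (a ∷ w) = cong (a ∷_) (enumerate-labels (suc k) w)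

enumerate-≥ : ∀ k w → All (λ y → k ≤ proj₁ y) (enumerate k w)
enumerate-≥ k []      = []
enumerate-≥ k (a ∷ w) = ≤-refl ∷ All.map (≤-trans (n≤1+n k)) (enumerate-≥ (suc k) w)

enumerate-sorted : ∀ k {w} → AllPairs _≤_ w → Sorted (enumerate k w)
enumerate-sorted k []                   = []
enumerate-sorted k (_∷_ {a} {w} a≤ ps) =
  All.tabulate (λ y∈ → All.lookup (enumerate-≥ (suc k) w) y∈ ,
    All.lookup a≤ (subst (_ ∈_) (enumerate-labels (suc k) w) (∈-map⁺ label y∈)))
  ∷ enumerate-sorted (suc k) ps

number-nodes : ∀ k t → nodes (number k t) ≡ enumerate k (nodes t)
number-nodes k (leaf _) = refl
number-nodes k (node l a r)
  rewrite number-nodes k l | number-nodes (suc (k + #nodes l)) r | #nodes≡length l =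
  ≡.sym (enumerate-++ k (nodes l) (a ∷ nodes r))

number-labels : ∀ k t → map label (nodes (number k t)) ≡ nodes t
number-labels k t = ≡.trans (cong (map label) (number-nodes k t)) (enumerate-labels k (nodes t))

number-mapₙ : ∀ k t → mapₙ label (number k t) ≡ t
number-mapₙ k (leaf _)     = refl
number-mapₙ k (node l a r) = cong₂ (λ l r → node l a r) (number-mapₙ k l) (number-mapₙ (suc (k + #nodes l)) r)

number-length : ∀ k t → length (nodes (number k t)) ≡ #nodes t
number-length k t = ≡.trans (≡.sym (length-map label (nodes (number k t))))
  (≡.trans (cong length (number-labels k t)) (≡.sym (#nodes≡length t)))

All-nodes : ∀ {Q : Pred Letter 0ℓ} {t : LTree} → TreeAll.All Q U t → All Q (nodes t)
All-nodes (TreeAll.leaf _)     = []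
All-nodes (TreeAll.node l x r) = All.++⁺ (All-nodes l) (x ∷ All-nodes r)

All-number : ∀ {Q : Pred Letter 0ℓ} k {t : LTree} → TreeAll.All Q U t →
  ∀ {y} → y ∈ nodes (number k t) → Q (label y)
All-number k {t} q y∈ = All.lookup (All-nodes q) (subst (_ ∈_) (number-labels k t) (∈-map⁺ label y∈))

inorder-sorted : ∀ {t} → LeftBST t → AllPairs _≤_ (nodes t)
inorder-sorted leaf           = []
inorder-sorted (node <b b≤ l r) = AllPairs.++⁺ (inorder-sorted l) (All-nodes b≤ ∷ inorder-sorted r)
  (All.map (λ a<b → <⇒≤ a<b ∷ All.map (≤-trans (<⇒≤ a<b)) (All-nodes b≤)) (All-nodes <b))

searchᴸ : ∀ k {t} → LeftBST t → L.Search (number k t)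
searchᴸ k leaf             = L.leaf
searchᴸ k (node {l} <b b≤ bl br) = L.node (All-number k <b)
  (λ y∈ y<b → <⇒≱ y<b (All-number (suc (k + #nodes l)) b≤ y∈))
  (searchᴸ k bl) (searchᴸ (suc (k + #nodes l)) br)

searchᴿ : ∀ k {t} → RightBST t → R.Search (number k t)
searchᴿ k leaf             = R.leaf
searchᴿ k (node {l} ≤b b< bl br) = R.node (All-number k ≤b)
  (λ y∈ → <⇒≱ (All-number (suc (k + #nodes l)) b< y∈))
  (searchᴿ k bl) (searchᴿ (suc (k + #nodes l)) br)

-- Equal labels go right in a left search tree, so the ancestor has the smaller index. For `tiesᴿ`
-- they go left.
tiesᴸ : ∀ {t y z} → L.Search t → Sorted (nodes t) → Above t y z → label y ≡ label z → proj₁ y < proj₁ z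
tiesᴸ (L.node left _ _ _) s (topˡ z∈) eq = ⊥-elim (<-irrefl (≡.sym eq) (left z∈))
tiesᴸ {node l _ _} (L.node _ _ _ _) s (topʳ z∈) eq = index< (Around.mid< (nodes l) s z∈)
tiesᴸ {node l _ _} (L.node _ _ sl _) s (inˡ a)  eq = tiesᴸ sl (Around.sortedˡ (nodes l) s) a eq
tiesᴸ {node l _ _} (L.node _ _ _ sr) s (inʳ a)  eq = tiesᴸ sr (Around.sortedʳ (nodes l) s) a eq

tiesᴿ : ∀ {t y z} → R.Search t → Sorted (nodes t) → Above t y z → label y ≡ label z → proj₁ z < proj₁ y
tiesᴿ (R.node _ right _ _) s (topʳ z∈) eq = ⊥-elim (right z∈ (≤-reflexive (≡.sym eq)))
tiesᴿ {node l _ _} (R.node _ _ _ _) s (topˡ z∈) eq = index< (Around.<mid (nodes l) s z∈)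
tiesᴿ {node l _ _} (R.node _ _ sl _) s (inˡ a)  eq = tiesᴿ sl (Around.sortedˡ (nodes l) s) a eq
tiesᴿ {node l _ _} (R.node _ _ _ sr) s (inʳ a)  eq = tiesᴿ sr (Around.sortedʳ (nodes l) s) a eq

-- Standardization

Standard : Rel Node 0ℓ
Standard y z = label y ≡ label z → proj₁ y < proj₁ z

extract-first : ∀ {a ns} → Sorted ns → a ∈ map label ns →
  ∃₂ λ x ys → Removal x ns ys × label x ≡ a × All (Standard x) ys
extract-first {a} {x ∷ ns} (p ∷ ps) a∈ with label x ≟ a
... | yes refl = x , ns , here , refl , All.map (λ x<y _ → index< x<y) p
... | no x≢a with a∈
...   | here a≡x  = ⊥-elim (x≢a (≡.sym a≡x))
...   | there a∈′ with extract-first ps a∈′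
...     | z , ys , ρ , refl , qs = z , x ∷ ys , there ρ , refl , (λ z≡x → ⊥-elim (x≢a (≡.sym z≡x))) ∷ qs

standardize : ∀ v {ns} → Sorted ns → v ↭ map label ns →
  ∃[ s ] s ↭ ns × map label s ≡ v × AllPairs Standard s
standardize [] {[]} _ _ = [] , ↭-refl , refl , []
standardize [] {_ ∷ _} _ v↭ with () ← ↭-empty-inv (↭-sym v↭)
standardize (a ∷ v) sorted v↭ with extract-first sorted (∈-resp-↭ v↭ (here refl))
... | x , ys , ρ , refl , first with standardize v (removal-AllPairs ρ sorted)
        (drop-∷ (↭-trans v↭ (map⁺ label (removal-↭ ρ))))
...   | s , s↭ , refl , std = x ∷ s , ↭-trans (prep x s↭) (↭-sym (removal-↭ ρ)) , refl ,
        All-resp-↭ (↭-sym s↭) first ∷ std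

AllPairs-reverse : ∀ {Q : Rel A 0ℓ} {xs} → AllPairs Q xs → AllPairs (flip Q) (reverse xs)
AllPairs-reverse [] = []
AllPairs-reverse {Q = Q} (_∷_ {x} {xs} p ps) rewrite unfold-reverse x xs =
  AllPairs.++⁺ (AllPairs-reverse ps) ([] ∷ [])
    (All-resp-↭ (↭-sym (↭-reverse xs)) (All.map (λ q → q ∷ []) p))

-- Canopies

data Chain {A : Set} (Q : Bool → Rel A 0ℓ) : List A → List Bool → Set where
  [-] : ∀ {x} → Chain Q (x ∷ []) []
  _∷_ : ∀ {x y xs b bs} → Q b x y → Chain Q (y ∷ xs) bs → Chain Q (x ∷ y ∷ xs) (b ∷ bs)

chain-++ : ∀ {Q : Bool → Rel A 0ℓ} xs {y ys bs cs} →
  Chain Q (xs ++ y ∷ []) bs → Chain Q (y ∷ ys) cs → Chain Q (xs ++ y ∷ ys) (bs ++ cs)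
chain-++ []           [-]     d = d
chain-++ (x ∷ [])     (q ∷ c) d = q ∷ chain-++ [] c d
chain-++ (x ∷ z ∷ xs) (q ∷ c) d = q ∷ chain-++ (z ∷ xs) c d

leaves : Bool → BTree A → List Bool
leaves s (leaf _)     = s ∷ []
leaves s (node l _ r) = leaves true l ++ leaves false r

Leaves≡leaves : ∀ s (t : BTree A) → Leaves.toList (markLeaves s t) ≡ leaves s t
Leaves≡leaves s t = ≡.trans (go s t []) (++-identityʳ (leaves s t))
  where
  go : ∀ {A : Set} s (t : BTree A) ks → Leaves.toDiffList (markLeaves s t) ks ≡ leaves s t ++ ks
  go s (leaf _) ks = refl
  go s (node l x r) ks = ≡.trans (go true l _)
    (≡.trans (cong (leaves true l ++_) (go false r ks))
      (≡.sym (++-assoc (leaves true l) (leaves false r) ks)))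

leaves-number : ∀ s k t → leaves s (number k t) ≡ leaves s t
leaves-number s k (leaf _) = refl
leaves-number s k (node l x r) =
  cong₂ _++_ (leaves-number true k l) (leaves-number false (suc (k + #nodes l)) r)

-- The leaf between two consecutive nodes is a left child exactly if the first one is the
-- ancestor of the other; a and c stand for the inorder neighbours of t in a larger tree.
leaves-chain : ∀ {Q : Bool → Rel A 0ℓ} s t {a c} →
  (∀ {y z} → Above t y z → Q true y z × Q false z y) →
  (nodes t ≡ [] → Q s a c) → (∀ {y} → y ∈ nodes t → Q true a y) → (∀ {y} → y ∈ nodes t → Q false y c) →
  Chain Q (a ∷ nodes t ++ c ∷ []) (leaves s t)
leaves-chain s (leaf _) inner empty first last = empty refl ∷ [-]
leaves-chain {Q = Q} s (node l x r) {a} {c} inner empty first last =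
  subst (λ ns → Chain Q (a ∷ ns) (leaves true l ++ leaves false r))
    (≡.sym (++-assoc (nodes l) (x ∷ nodes r) (c ∷ [])))
    (chain-++ (a ∷ nodes l)
      (leaves-chain true l (inner ∘ inˡ) (λ _ → first (∈-at (nodes l))) (first ∘ ∈-before)
        (proj₂ ∘ inner ∘ topˡ))
      (leaves-chain false r (inner ∘ inʳ) (λ _ → last (∈-at (nodes l))) (proj₁ ∘ inner ∘ topʳ)
        (last ∘ ∈-after (nodes l))))

-- This drops the two outermost leaves, that is, the pairs formed with the added ends `a` and `c`.
chain-inner : ∀ {Q : Bool → Rel A 0ℓ} {a c y} ys {bs} →
  Chain Q (a ∷ y ∷ ys ++ c ∷ []) bs → Chain Q (y ∷ ys) (take (length ys) (drop 1 bs))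
chain-inner ys (_ ∷ c) = trim ys c
  where
  trim : ∀ {Q : Bool → Rel A 0ℓ} {c y} ys {bs} → Chain Q (y ∷ ys ++ c ∷ []) bs →
    Chain Q (y ∷ ys) (take (length ys) bs)
  trim []       (_ ∷ _) = [-]
  trim (z ∷ ys) (q ∷ c) = q ∷ trim ys c

Sign : BTree Node → Bool → Rel Node 0ℓ
Sign t true  y z = Above t y z
Sign t false y z = Above t z y

-- Indices start at 1, so this is not a node of a numbered tree.
sentinel : Node
sentinel = 0 , 0

-- The guards make the pairs involving the sentinel hold vacuously.
InnerSign : BTree Node → Bool → Rel Node 0ℓ
InnerSign t b y z = y ≢ sentinel → z ≢ sentinel → Sign t b y z

canopy-chain : ∀ k t {y ys} → nodes (number k t) ≡ y ∷ ys →
  Chain (InnerSign (number k t)) (y ∷ ys) (canopy t)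
canopy-chain k t {y} {ys} eq
  -- The node count becomes `suc (length ys)`, so the canopy takes `length ys` bits, one for each
  -- gap between consecutive nodes.
  rewrite ≡.trans (≡.sym (number-length k t)) (cong length eq)
        | Leaves≡leaves true t | ≡.sym (leaves-number true k t) =
  chain-inner ys (subst
    (λ ns → Chain (InnerSign (number k t)) (sentinel ∷ ns ++ sentinel ∷ []) (leaves true (number k t)))
    eq
    (leaves-chain true (number k t) (λ a → (λ _ _ → a) , (λ _ _ → a))
      (λ _ s≢s → ⊥-elim (s≢s refl)) (λ _ s≢s → ⊥-elim (s≢s refl)) (λ _ _ s≢s → ⊥-elim (s≢s refl))))

-- Neighbours in a sorted list are consecutive entries; at their position the two chains carry
-- different bits.
twin-signs : ∀ {Q S : Bool → Rel Node 0ℓ} {ns bs cs y z} → Chain Q ns bs → Chain S ns cs →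
  Pointwise _≢_ bs cs → Sorted ns → Neighbours ns y z → ∃₂ λ b c → b ≢ c × Q b y z × S c y z
twin-signs [-] [-] [] s nb with Neighbours.y∈ nb | Neighbours.z∈ nb
... | here refl | here refl = ⊥-elim (<ᴺ-irrefl (Neighbours.y<z nb))
twin-signs {ns = x ∷ w ∷ ns} (q ∷ qs) (s ∷ ss) (b≢c ∷ ≢s) (p ∷ p′ ∷ ps) nb
  with Neighbours.y∈ nb | Neighbours.z∈ nb
... | here refl | here refl = ⊥-elim (<ᴺ-irrefl (Neighbours.y<z nb))
... | here refl | there (here refl) = _ , _ , b≢c , q , s
... | here refl | there (there z∈) =
  ⊥-elim (Neighbours.gap nb (there (here refl)) (All.lookup p (here refl)) (All.lookup p′ z∈))
... | there y∈ | here refl = ⊥-elim (<ᴺ-asym (Neighbours.y<z nb) (All.lookup p y∈))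
... | there y∈ | there z∈ = twin-signs qs ss ≢s (p′ ∷ ps) record
  { y∈ = y∈ ; z∈ = z∈ ; y<z = Neighbours.y<z nb ; gap = Neighbours.gap nb ∘ there }

-- The encoded class as linear extensions

module _ {TL TR : LTree} (twins : IsTwinBST TL TR) where

  open IsTwinBST twins

  private
    F : Forest
    F = plant (number 1 TL) []

    Tᴸ Tᴿ : BTree Node
    Tᴸ = number 1 TL
    Tᴿ = number 1 TR

    labels≡ : nodes TL ≡ nodes TR
    labels≡ = ≡.trans (≡.sym (inorder≡nodes TL)) (≡.trans (IsTwinBST.inorder≡ twins) (inorder≡nodes TR))

    nodes≡ : nodes Tᴸ ≡ nodes Tᴿ
    nodes≡ = ≡.trans (number-nodes 1 TL) (≡.trans (cong (enumerate 1) labels≡) (≡.sym (number-nodes 1 TR)))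

    sortedᴸ : Sorted (nodes Tᴸ)
    sortedᴸ = subst Sorted (≡.sym (number-nodes 1 TL)) (enumerate-sorted 1 (inorder-sorted leftBST))

    sortedᴿ : Sorted (nodes Tᴿ)
    sortedᴿ = subst Sorted nodes≡ sortedᴸ

    planted-nodes : nodesᶠ F ≡ nodes Tᴸ
    planted-nodes = ≡.trans (plant-nodes Tᴸ) (++-identityʳ (nodes Tᴸ))

    planted⁻ : ∀ {y z} → Aboveᶠ F y z → Above Tᴸ y z
    planted⁻ a with plant-aboveᶠ Tᴸ a
    ... | inj₁ a′ = a′

    ≢sentinel : ∀ {y} → y ∈ nodes Tᴿ → y ≢ sentinel
    ≢sentinel y∈ refl with () ← All.lookup (enumerate-≥ 1 (nodes TR)) (subst (_ ∈_) (number-nodes 1 TR) y∈)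

    -- The leaf between two neighbours is a left child in one tree and a right child in the other,
    -- which reverses the ancestor relation.
    opposite : ∀ {y z} → Neighbours (nodes Tᴿ) y z →
      (Above Tᴸ y z × Above Tᴿ z y) ⊎ (Above Tᴸ z y × Above Tᴿ y z)
    opposite {y} {z} nb = signs nb (≢sentinel (Neighbours.y∈ nb)) (≢sentinel (Neighbours.z∈ nb))
      where
      signs : Neighbours (nodes Tᴿ) y z → y ≢ sentinel → z ≢ sentinel →
        (Above Tᴸ y z × Above Tᴿ z y) ⊎ (Above Tᴸ z y × Above Tᴿ y z)
      signs nb y≢ z≢ with nodes Tᴿ in eq
      ... | [] with () ← Neighbours.y∈ nb
      ... | x ∷ xs with twin-signs (canopy-chain 1 TL (≡.trans nodes≡ eq)) (canopy-chain 1 TR eq)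
                          twin (subst Sorted eq sortedᴿ) nb
      ...   | true  , true  , b≢c , _ , _ = ⊥-elim (b≢c refl)
      ...   | false , false , b≢c , _ , _ = ⊥-elim (b≢c refl)
      ...   | true  , false , _   , q , s = inj₁ (q y≢ z≢ , s y≢ z≢)
      ...   | false , true  , _   , q , s = inj₂ (q y≢ z≢ , s y≢ z≢)

  initial-state : State F Tᴿ
  initial-state = record
    { nodes≡ = ≡.trans planted-nodes nodes≡
    ; sorted = sortedᴿ
    ; twinʳ  = λ nb a b → case opposite nb of λ where
        (inj₁ (_ , b′)) → above-asym sortedᴿ b b′
        (inj₂ (a′ , _)) → above-asym sortedᴸ (planted⁻ a) a′
    ; twinˡ  = λ nb a b → case opposite nb of λ where
        (inj₁ (a′ , _)) → above-asym sortedᴸ (planted⁻ a) a′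
        (inj₂ (_ , b′)) → above-asym sortedᴿ b b′
    }

  -- For `TL` ancestors come first in `s`. For `TR` descendants do, so ancestors come first in the
  -- reversed list, which is the order of insertion.
  linear⇒P : ∀ {s} → LinearExtension F Tᴿ s → P (map label s) ≡ (TL , TR)
  linear⇒P {s} (s↭ , ps) = cong₂ _,_
    (≡.trans (treeᴸ (map label s)) (≡.trans
      (L.insertAll-linear (searchᴸ 1 leftBST) (↭-trans s↭ (↭-reflexive (≡.sym nodes≡)))
        (AllPairs.map (λ (¬a , _) → ¬a ∘ plant-hereᶠ) ps))
      (number-mapₙ 1 TL)))
    (≡.trans (treeᴿ (map label s)) (≡.trans
      (≡.trans (cong (R.insertAll ∙) (≡.sym (reverse-map label s)))
        (R.insertAll-linear (searchᴿ 1 rightBST) (↭-trans (↭-reverse s) s↭)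
          (AllPairs-reverse (AllPairs.map proj₂ ps))))
      (number-mapₙ 1 TR)))

  -- Standardization assigns nodes to the letters of `v`. Its order on equal letters agrees with
  -- `tiesᴸ`, and read backwards with `tiesᴿ`, so `insertAll-linear⁻` applies to both trees.
  P⇒linear : ∀ {v} → P v ≡ (TL , TR) → ∃[ s ] map label s ≡ v × LinearExtension F Tᴿ s
  P⇒linear {v} eq with standardize v sortedᴸ v↭
    where
    v↭ : v ↭ map label (nodes Tᴸ)
    v↭ = ↭-trans (↭-sym (↭-trans (L.insertAll-↭ ∙ v) (↭-reflexive (++-identityʳ v))))
      (↭-reflexive (≡.trans (cong nodes (≡.trans (≡.sym (treeᴸ v)) (cong proj₁ eq)))
        (≡.sym (number-labels 1 TL))))
  ... | s , s↭ , refl , std = s , refl , ↭-trans s↭ (↭-reflexive nodes≡) ,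
    AllPairs.zip (AllPairs.map (_∘ planted⁻) orderᴸ , orderᴿ)
    where
    orderᴸ : AllPairs (λ y z → ¬ Above Tᴸ z y) s
    orderᴸ = L.insertAll-linear⁻ {_≪_ = λ y z → proj₁ y < proj₁ z} (searchᴸ 1 leftBST) sortedᴸ
      (tiesᴸ (searchᴸ 1 leftBST) sortedᴸ) s↭
      (AllPairs.map (λ y<z eq z<y → <-irrefl refl (<-trans (y<z eq) z<y)) std)
      (≡.trans (≡.sym (treeᴸ (map label s))) (≡.trans (cong proj₁ eq) (≡.sym (number-mapₙ 1 TL))))
    orderᴿ : AllPairs (λ y z → ¬ Above Tᴿ y z) s
    orderᴿ = subst (AllPairs _) (reverse-involutive s) (AllPairs-reverse
      (R.insertAll-linear⁻ {_≪_ = λ y z → proj₁ z < proj₁ y} (searchᴿ 1 rightBST) sortedᴿ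
        (tiesᴿ (searchᴿ 1 rightBST) sortedᴿ) (↭-trans (↭-reverse s) (↭-trans s↭ (↭-reflexive nodes≡)))
        (AllPairs.map (λ z<y eq y<z → <-irrefl refl (<-trans (z<y (≡.sym eq)) y<z)) (AllPairs-reverse std))
        (≡.trans (cong (R.insertAll ∙) (reverse-map label s))
          (≡.trans (≡.sym (treeᴿ (map label s))) (≡.trans (cong proj₂ eq) (≡.sym (number-mapₙ 1 TR)))))))

  permutation : LabeledByPermutation TL TR → ∀ {s} → LinearExtension F Tᴿ s →
    IsPermutation (#nodes TL) (map label s)
  permutation (TL↭ , _) {s} (s↭ , _) = record
    { length≡  = ≡.trans (↭-length w↭) (length-upTo (#nodes TL))
    ; unique   = Unique-resp-↭ (≡.setoid ℕ) (↭⇒↭ₛ (↭-sym w↭)) (upTo⁺ (#nodes TL))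
    ; letters< = All-resp-↭ (↭-sym w↭) (all-upTo (#nodes TL))
    }
    where
    w↭ : map label s ↭ upTo (#nodes TL)
    w↭ = ↭-trans (map⁺ label s↭) (↭-trans (↭-reflexive
      (≡.trans (number-labels 1 TR) (≡.trans (≡.sym labels≡) (≡.sym (inorder≡nodes TL))))) TL↭)

  class⇒linear : ∀ {v} → EncodedBy TL TR v → ∃[ s ] map label s ≡ v × LinearExtension F Tᴿ s
  class⇒linear (u , eq , u≡v) = P⇒linear (≡.trans (≡.sym (P-≡ᴮ u≡v)) eq)

  optimal : ∀ {choose} (direction : Direction choose) → let open Direction direction in
    ∃[ w ] extract choose TL TR ≡ just w × EncodedBy TL TR w × (∀ v → EncodedBy TL TR v → w ≼ v)
      × (LabeledByPermutation TL TR → IsPermutation (#nodes TL) w)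
  optimal direction with Greedy.greedy direction (#nodes TR) [] F Tᴿ initial-state (number-length 1 TR)
  -- The greedy word is its own representative in the class.
  ... | w , w≡ , ext , least = map label w , w≡ , (map label w , linear⇒P ext , refl) ,
    (λ v v∈ → case class⇒linear v∈ of λ { (s , refl , ext′) → least ext′ }) ,
    λ perm → permutation perm ext

-- The permutohedron order and the two directions

⋖-cons : ∀ a {u v} → u ⋖ v → a ∷ u ⋖ a ∷ v
⋖-cons a (swap u v a<b) = swap (a ∷ u) v a<b

≤ᴾ-swap : ∀ {x y} u → x <ᴺ y → label x ∷ label y ∷ u ≤ᴾ label y ∷ label x ∷ u
≤ᴾ-swap u (_ , a≤b) with m≤n⇒m<n∨m≡n a≤b
... | inj₁ a<b  = swap [] u a<b ◅ ε
-- Exchanging equal letters does not change the word.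
... | inj₂ refl = ε

-- A cover raises the first letter in which the two words differ.
≤ᴾ⇒≤ˡᵉˣ : ∀ {u v} → u ≤ᴾ v → u ≤ˡᵉˣ v
≤ᴾ⇒≤ˡᵉˣ ε        = Lex.≤-reflexive _≡_ _<_ (Pointwise.refl refl)
≤ᴾ⇒≤ˡᵉˣ (c ◅ cs) = Lex.≤-transitive ≡.isEquivalence <-resp₂-≡ <-trans (cover c) (≤ᴾ⇒≤ˡᵉˣ cs)
  where
  cover : ∀ {u v} → u ⋖ v → u ≤ˡᵉˣ v
  cover (swap []      v a<b) = this a<b
  cover (swap (x ∷ u) v a<b) = next refl (cover (swap u v a<b))

upwards : Direction smallest
upwards = record
  { _≺_ = _<ᴺ_ ; total = compare ; between = up
  ; chosen = λ x xs → argmin proj₁ x xs , refl , [ here , there ]′ (argmin-sel proj₁ x xs) , λ where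
      (here refl) z< → <⇒≱ (index< z<) (f[argmin]≤f[⊤] {f = proj₁} x xs)
      (there z∈)  z< → <⇒≱ (index< z<) (All.lookup (f[argmin]≤f[xs] {f = proj₁} x xs) z∈)
  ; _≼_ = _≤ᴾ_ ; ≼-refl = ε ; ≼-trans = _◅◅_ ; ≼-cons = λ a → Star.gmap (a ∷_) (⋖-cons a)
  ; ≼-swap = ≤ᴾ-swap
  }

downwards : Direction greatest
downwards = record
  { _≺_ = flip _<ᴺ_
  ; total = λ s x∈ y∈ → Sum.map₂ Sum.swap (compare s x∈ y∈)
  ; between = λ y<x z<y → down z<y y<x
  ; chosen = λ x xs → argmax proj₁ x xs , refl , [ here , there ]′ (argmax-sel proj₁ x xs) , λ where
      (here refl) z> → <⇒≱ (index< z>) (f[⊥]≤f[argmax] {f = proj₁} x xs)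
      (there z∈)  z> → <⇒≱ (index< z>) (All.lookup (f[xs]≤f[argmax] {f = proj₁} x xs) z∈)
  ; _≼_ = flip _≤ᴾ_ ; ≼-refl = ε ; ≼-trans = λ v≤u w≤v → w≤v ◅◅ v≤u
  ; ≼-cons = λ a → Star.gmap (a ∷_) (⋖-cons a)
  ; ≼-swap = λ u y<x → ≤ᴾ-swap u y<x
  }

proposition4p16 : ∀ (TL TR : LTree) → IsTwinBST TL TR →
    (∃[ w ] (extractMin TL TR ≡ just w
    × IsLeast _≤ˡᵉˣ_ (EncodedBy TL TR) w
    × (LabeledByPermutation TL TR →
    IsLeast _≤ᴾ_ (IsPermutation (#nodes TL) ∩ EncodedBy TL TR) w)))
    × (∃[ w ] (extractMax TL TR ≡ just w
    × IsGreatest _≤ˡᵉˣ_ (EncodedBy TL TR) w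
    × (LabeledByPermutation TL TR →
    IsGreatest _≤ᴾ_ (IsPermutation (#nodes TL) ∩ EncodedBy TL TR) w)))
proposition4p16 TL TR twins with optimal twins upwards | optimal twins downwards
... | w , w≡ , w∈ , least , perm | w′ , w′≡ , w′∈ , greatest , perm′ =
  -- The bound in `_≤ᴾ_` holds against every word of the class, hence against its permutations, and
  -- yields the lexicographic bound.
  (w , w≡ , (w∈ , λ v v∈ → ≤ᴾ⇒≤ˡᵉˣ (least v v∈)) ,
    λ labeled → (perm labeled , w∈) , λ v (_ , v∈) → least v v∈) ,
  (w′ , w′≡ , (w′∈ , λ v v∈ → ≤ᴾ⇒≤ˡᵉˣ (greatest v v∈)) ,
    λ labeled → (perm′ labeled , w′∈) , λ v (_ , v∈) → greatest v v∈)
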